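{- Let $n,m\ge 1$ be integers and $V(n,m)=\{1,\dots,n\}\times\{1,\dots,m\}$. The minimum number of edges of a (possibly self-crossing) geometric tree covering $V(n,m)$ is $2\min(n,m)-2$ if $n=m\ge 3$, and $2\min(n,m)-1$ otherwise. The minimum number of edges of a noncrossing geometric tree covering $V(n,m)$ is $2\min(n,m)-1$ for all $n,m\ge 1$.
   Context: A geometric tree is a finite abstract tree with at least one edge whose vertices are distinct points of the plane (arbitrary points, not necessarily in $V(n,m)$) and whose edges are drawn as the closed straight-line segments between their endpoints. It covers a point set $P$ if every point of $P$ lies on the union of its edges. It is noncrossing if any two edges intersect only if they share an endpoint, and then only in that endpoint. -}

module Defs where

open import Level using (Level; _⊔_) renaming (zero to ℓ0; suc to lsuc)
open import Algebra.Apartness.Bundles using (HeytingField)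
open import Algebra.Bundles using (CommutativeRing)
import Algebra.Definitions.RawMonoid as Multiples
open import Data.Fin.Base as Fin using (Fin; inject₁; fromℕ)
open import Data.Nat.Base as ℕ using (ℕ)
open import Data.Product.Base using (Σ-syntax; ∃-syntax; _×_; _,_; proj₁; proj₂)
open import Data.Sum.Base using (_⊎_)
open import Function.Bundles using (_⇔_)
open import Function.Definitions using (Injective)
open import Relation.Binary.Construct.Closure.ReflexiveTransitive using (Star)
open import Relation.Binary.Core using (Rel)
open import Relation.Binary.PropositionalEquality.Core using (_≡_; _≢_)
open import Relation.Binary.Structures using (IsStrictPartialOrder)
open import Relation.Nullary.Negation.Core using (¬_)

-- The real numbers, axiomatised as a Cauchy-complete Archimedean ordered
-- field.  The axioms are constructive: Bishop's Cauchy reals satisfy them, and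
-- under excluded middle they determine ℝ up to unique isomorphism.  In
-- particular the order is not assumed decidable.
record RealNumbers (c ℓ₁ ℓ₂ ℓ₃ : Level) : Set (lsuc (c ⊔ ℓ₁ ⊔ ℓ₂ ⊔ ℓ₃)) where
  field
    heytingField : HeytingField c ℓ₁ ℓ₂

  open HeytingField heytingField public

  commutativeRing : CommutativeRing c ℓ₁
  commutativeRing = record { isCommutativeRing = isCommutativeRing }

  open Multiples (CommutativeRing.+-rawMonoid commutativeRing) public
    using () renaming (_×_ to infixr 8 _·_)

  infix 4 _<_ _≤_

  field
    _<_                  : Rel Carrier ℓ₃
    isStrictPartialOrder : IsStrictPartialOrder _≈_ _<_
    #⇔<⊎>                : ∀ x y → x # y ⇔ (x < y ⊎ y < x)
    +-monoʳ-<            : ∀ x {y z} → y < z → x + y < x + z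
    *-pos                : ∀ {x y} → 0# < x → 0# < y → 0# < x * y

  _≤_ : Rel Carrier ℓ₃
  x ≤ y = ¬ (y < x)

  fromNat : ℕ → Carrier
  fromNat k = k · 1#

  -- The order of i and j is arbitrary, so this bounds |x i - x j|.
  IsCauchy : (ℕ → Carrier) → Set (c ⊔ ℓ₃)
  IsCauchy x = ∀ ε → 0# < ε →
    ∃[ N ] (∀ i j → N ℕ.≤ i → N ℕ.≤ j → x i - x j < ε)

  _ConvergesTo_ : (ℕ → Carrier) → Carrier → Set (c ⊔ ℓ₃)
  x ConvergesTo l = ∀ ε → 0# < ε →
    ∃[ N ] (∀ i → N ℕ.≤ i → (x i - l < ε) × (l - x i < ε))

  field
    archimedean : ∀ x → ∃[ k ] (x < fromNat k)
    complete    : ∀ x → IsCauchy x → ∃[ l ] (x ConvergesTo l)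

-- Finite simple graphs with v vertices and e edges; the undirected edge {a , b}
-- is stored once, as the pair with the smaller vertex first.
record Graph (v e : ℕ) : Set where
  field
    ends      : Fin e → Fin v × Fin v
    ordered   : ∀ k → proj₁ (ends k) Fin.< proj₂ (ends k)
    injective : Injective _≡_ _≡_ ends

  Adjacent : Rel (Fin v) ℓ0
  Adjacent a b = ∃[ k ] (ends k ≡ (a , b) ⊎ ends k ≡ (b , a))

  IsEndpoint : Fin v → Fin e → Set
  IsEndpoint a k = a ≡ proj₁ (ends k) ⊎ a ≡ proj₂ (ends k)

  Connected : Set
  Connected = ∀ a b → Star Adjacent a b

  -- A cycle has length l + 3 and visits w 0, …, w (l + 2), and then w 0 again.
  record Cycle : Set where
    field
      l        : ℕ
      w        : Fin (3 ℕ.+ l) → Fin v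
      distinct : Injective _≡_ _≡_ w
      step     : ∀ i → Adjacent (w (inject₁ i)) (w (Fin.suc i))
      closing  : Adjacent (w (fromℕ (2 ℕ.+ l))) (w Fin.zero)

  Acyclic : Set
  Acyclic = ¬ Cycle

module _ {c ℓ₁ ℓ₂ ℓ₃} (ℝ : RealNumbers c ℓ₁ ℓ₂ ℓ₃) where

  open RealNumbers ℝ

  Point : Set c
  Point = Carrier × Carrier

  infix 4 _≈ₚ_

  _≈ₚ_ : Rel Point ℓ₁
  (x , y) ≈ₚ (x′ , y′) = (x ≈ x′) × (y ≈ y′)

  -- p = (1 - t) a + t b for some t in [0 , 1].
  OnSegment : Point → Point → Point → Set (c ⊔ ℓ₁ ⊔ ℓ₃)
  OnSegment (a₁ , a₂) (b₁ , b₂) p =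
    ∃[ t ] ((0# ≤ t) × (t ≤ 1#) ×
      (p ≈ₚ ((1# - t) * a₁ + t * b₁ , (1# - t) * a₂ + t * b₂)))

  record GeometricTree (e : ℕ) : Set (c ⊔ ℓ₁) where
    field
      e≥1       : 1 ℕ.≤ e
      v         : ℕ
      graph     : Graph v e
      connected : Graph.Connected graph
      acyclic   : Graph.Acyclic graph
      position  : Fin v → Point
      distinct  : Injective _≡_ _≈ₚ_ position

    open Graph graph public using (ends; IsEndpoint)

    OnEdge : Fin e → Point → Set (c ⊔ ℓ₁ ⊔ ℓ₃)
    OnEdge k = OnSegment (position (proj₁ (ends k))) (position (proj₂ (ends k)))

    Covers : ∀ {ℓ} → (Point → Set ℓ) → Set (c ⊔ ℓ₁ ⊔ ℓ₃ ⊔ ℓ)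
    Covers P = ∀ p → P p → ∃[ k ] OnEdge k p

    Noncrossing : Set (c ⊔ ℓ₁ ⊔ ℓ₃)
    Noncrossing = ∀ k k′ → k ≢ k′ → ∀ p → OnEdge k p → OnEdge k′ p →
      ∃[ a ] (IsEndpoint a k × IsEndpoint a k′ × (p ≈ₚ position a))

  -- V(n,m) = {1,…,n} × {1,…,m}.
  V : ℕ → ℕ → Point → Set ℓ₁
  V n m p = ∃[ i ] ∃[ j ]
    ((1 ℕ.≤ i × i ℕ.≤ n) × (1 ℕ.≤ j × j ℕ.≤ m) × (p ≈ₚ (fromNat i , fromNat j)))

  CoveringTree : ℕ → ℕ → ℕ → Set (c ⊔ ℓ₁ ⊔ ℓ₃)
  CoveringTree n m e = Σ[ T ∈ GeometricTree e ] GeometricTree.Covers T (V n m)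

  NoncrossingCoveringTree : ℕ → ℕ → ℕ → Set (c ⊔ ℓ₁ ⊔ ℓ₃)
  NoncrossingCoveringTree n m e = Σ[ T ∈ GeometricTree e ]
    (GeometricTree.Noncrossing T × GeometricTree.Covers T (V n m))

IsMinimum : ∀ {ℓ} → (ℕ → Set ℓ) → ℕ → Set ℓ
IsMinimum P k = P k × (∀ e → P e → k ℕ.≤ e)

{-# OPTIONS --safe #-}
module Submission where

-- Lower bounds.  A connected graph with e edges has at most e + 1 vertices, so
-- if every row (or every column) contains an edge, the disjointness of these
-- edges gives e ≥ 2 min(n, m) − 1.  Otherwise let A × B be the subgrid of the
-- rows and columns that contain no edge.  It is covered by oblique edges, each
-- of which meets the boundary of its bounding rectangle at most twice, and
-- counting these incidences together with the remaining rows and columns gives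
-- e ≥ n + m − 2, or n + m − 1 if the rectangle is degenerate.  In the case of
-- equality e = n + m − 2 every oblique edge meets the boundary exactly twice.
-- Then the edge through a corner separates a neighbouring corner from all
-- points to which that corner could be joined, so two edges cross properly.
-- This is impossible in a noncrossing tree, and also in a tree with at most two
-- edges, where any two edges share an endpoint.
--
-- Upper bounds.  A comb is a noncrossing tree with 2 min(n, m) − 1 edges.  On a
-- square grid, a four-edge tree for the inner 3 × 3 square is extended by a
-- spiral with two edges for each further row and column.

open import Defs
open import Level as Level using (Level; _⊔_) renaming (suc to lsuc)
open import Algebra.Bundles using (CommutativeRing; RawRing)
import Algebra.Apartness.Properties.HeytingCommutativeRing as HeytingProperties
import Algebra.Properties.CommutativeSemigroup as CommutativeSemigroupProperties
import Algebra.Properties.Ring as RingProperties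
import Algebra.Properties.Semiring.Mult as SemiringMult
import Algebra.Solver.Ring as RingSolver
open import Algebra.Solver.Ring.AlmostCommutativeRing
  using (fromCommutativeRing; _-Raw-AlmostCommutative⟶_; Induced-equivalence)
open import Data.Bool.Base using (Bool; true; false; not)
open import Data.Bool.Properties using (not-involutive)
open import Data.Fin.Base as Fin
  using (Fin; zero; suc; toℕ; fromℕ; inject₁; punchIn; punchOut; splitAt; _↑ˡ_; _↑ʳ_)
import Data.Fin.Properties as Fin
open import Data.Fin.Relation.Unary.Top using (view; ‵fromℕ; ‵inject₁)
open import Data.Maybe.Base using (just; nothing)
open import Data.Nat.Base as ℕ using (ℕ; zero; suc; z≤n; s≤s)
import Data.Nat.Properties as ℕ
open import Data.Nat.Solver using (module +-*-Solver)
open import Data.Product.Base as Product using (_×_; _,_; proj₁; proj₂; ∃; ∃₂; ∃-syntax; swap)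
open import Data.Product.Function.NonDependent.Propositional using (_×-↔_)
open import Data.Product.Properties using (≡-dec)
open import Data.Sum.Base as Sum using (_⊎_; inj₁; inj₂; [_,_]′)
open import Effect.Monad using (RawMonad)
open import Function.Base using (_∘_; id; flip; case_of_)
open import Function.Bundles using (_↔_; Equivalence; Inverse; Injection)
open import Function.Construct.Composition using (_↔-∘_)
open import Function.Definitions using (Injective)
open import Function.Properties.Inverse using (↔-refl; ↔-sym; ↔⇒↣)
open import Relation.Binary.Construct.Closure.ReflexiveTransitive
  using (Star; ε; _◅_; _◅◅_; reverse)
open import Relation.Binary.Definitions using (WeaklyDecidable; tri<; tri≈; tri>)
open import Relation.Binary.PropositionalEquality
  using (_≡_; _≢_; refl; sym; trans; cong; cong₂; subst; subst₂; ≢-sym)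
import Relation.Binary.Reasoning.Setoid as SetoidReasoning
open import Relation.Binary.Structures using (IsStrictPartialOrder)
open import Relation.Nullary using (Dec; yes; no; ¬_; ¬?; contradiction; decidable-stable)
open import Relation.Nullary.Decidable using (¬¬-excluded-middle; _⊎-dec_)
open import Relation.Nullary.Negation using (¬¬-Monad; ¬¬-map)
open import Relation.Unary using (Pred; Decidable)

-- The order on the real numbers is not assumed decidable, but the counting must know which grid
-- lines contain an edge and which edges rise. Its conclusions compare natural numbers and are
-- therefore stable, so these finitely many questions may be settled under a double negation.
-- `Incidence` then isolates what the counting uses; rows and columns are interchangeable there, and
-- the vertex count of the tree enters only through `all-rows` and `all-columns`.
--
-- Boundary points count by halves, so every edge gets two slots and every counted grid line makes
-- two claims. If the bound is attained, no slot is empty, and the claim on a slot exhibits a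
-- further point of the edge.
--
-- Two edges that cross properly share no endpoint at all, since such a point would be a second
-- intersection of their lines. So `IntersectionsShared` is all that is asked of the tree.
--
-- In the spiral, grid lines are numbered alternately outward from the centre, so that a segment
-- between consecutive numbers passes through all smaller ones.

private variable
  ℓ ℓ′ ℓ″ : Level
  A : Set ℓ
  B : Set ℓ′
  n m e : ℕ

-- Counting

-- The two copies are the two claims of a grid line, the two slots of an edge, or its two ends;
-- counting pairs avoids halves.
doubled : Fin n ↔ A → Fin (n ℕ.* 2) ↔ (A × Bool)
doubled α = (α ×-↔ Fin.2↔Bool) ↔-∘ Fin.*↔×

to-injective : (α : A ↔ B) → Injective _≡_ _≡_ (Inverse.to α)
to-injective α = Injection.injective (↔⇒↣ α)

-- Choosing a claim for every x turns T into an injection.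
module _ (α : Fin n ↔ A) (β : Fin m ↔ B) (T : A → B → Set ℓ″)
  (total : ∀ x → ∃ (T x)) (claimed-once : ∀ {x x′ y} → T x y → T x′ y → x ≡ x′) where

  private
    claim : Fin n → Fin m
    claim i = Inverse.from β (proj₁ (total (Inverse.to α i)))

    claims : ∀ {i y} → claim i ≡ Inverse.from β y → T (Inverse.to α i) y
    claims {i} eq = subst (T _) (to-injective (↔-sym β) eq) (proj₂ (total (Inverse.to α i)))

    claim-injective : Injective _≡_ _≡_ claim
    claim-injective {i} {j} eq =
      to-injective α (claimed-once (claims eq) (proj₂ (total (Inverse.to α j))))

  claims-≤ : n ℕ.≤ m
  claims-≤ = Fin.injective⇒≤ claim-injective

  -- An unclaimed `y` can be the image of one additional source. So a bound that is attained leaves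
  -- no target unclaimed.
  claimed-or-< : ∀ y → (∃[ x ] T x y) ⊎ n ℕ.< m
  claimed-or-< y with Fin.any? (λ i → claim i Fin.≟ Inverse.from β y)
  ... | yes (i , eq) = inj₁ (Inverse.to α i , claims eq)
  ... | no unclaimed = inj₂ (Fin.injective⇒≤ extended-injective)
    where
    extended : Fin (suc n) → Fin m
    extended zero    = Inverse.from β y
    extended (suc i) = claim i

    extended-injective : Injective _≡_ _≡_ extended
    extended-injective {zero}  {zero}  eq = refl
    extended-injective {zero}  {suc i} eq = contradiction (i , sym eq) unclaimed
    extended-injective {suc i} {zero}  eq = contradiction (i , eq) unclaimed
    extended-injective {suc i} {suc j} eq = cong suc (claim-injective eq)

extrema : {P : Pred (Fin n) ℓ} → Decidable P → (∀ i → ¬ P i) ⊎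
  ∃₂ λ lo hi → P lo × P hi × (∀ {i} → P i → lo Fin.≤ i × i Fin.≤ hi)
extrema {n = zero} P? = inj₁ λ ()
extrema {n = suc n} P? with P? zero | extrema (P? ∘ suc)
... | no ¬p | inj₁ none = inj₁ λ { zero → ¬p ; (suc i) → none i }
... | no ¬p | inj₂ (lo , hi , plo , phi , between) =
  inj₂ (suc lo , suc hi , plo , phi , λ
    { {zero} p → contradiction p ¬p
    ; {suc i} p → s≤s (proj₁ (between p)) , s≤s (proj₂ (between p)) })
... | yes p₀ | inj₁ none =
  inj₂ (zero , zero , p₀ , p₀ , λ
    { {zero} p → z≤n , z≤n ; {suc i} p → contradiction p (none i) })
... | yes p₀ | inj₂ (lo , hi , plo , phi , between) =
  inj₂ (zero , suc hi , p₀ , phi , λ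
    { {zero} p → z≤n , z≤n ; {suc i} p → z≤n , s≤s (proj₂ (between p)) })

-- Merging labels along one edge at a time loses at most one label per edge.
merge-labels : ∀ e (ends : Fin e → Fin n × Fin n) →
  ∃[ c ] n ℕ.≤ e ℕ.+ c × ∃₂ λ (label : Fin n → Fin c) (representative : Fin c → Fin n) →
    (∀ i → label (representative i) ≡ i) ×
    (∀ k → label (proj₁ (ends k)) ≡ label (proj₂ (ends k)))
merge-labels {n} zero ends = n , ℕ.≤-refl , id , id , (λ _ → refl) , λ ()
merge-labels {n} (suc e) ends with merge-labels e (ends ∘ suc)
... | c , n≤e+c , label , rep , label-rep , glued
  with label (proj₁ (ends zero)) Fin.≟ label (proj₂ (ends zero))
... | yes a≡b = c , ℕ.≤-trans n≤e+c (ℕ.n≤1+n _) , label , rep , label-rep ,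
  λ { zero → a≡b ; (suc k) → glued k }
merge-labels {n} (suc e) ends | zero  , n≤e+c , label , rep , label-rep , glued | no a≢b
  with () ← label (proj₁ (ends zero))
merge-labels {n} (suc e) ends | suc c , n≤e+c , label , rep , label-rep , glued | no a≢b =
  c , subst (n ℕ.≤_) (ℕ.+-suc e c) n≤e+c , merge ∘ label , rep ∘ punchIn b ,
  (λ i → trans (cong merge (label-rep (punchIn b i))) (merge-punchIn i)) ,
  λ { zero → trans (merge-punchIn′ a≢b) (sym merge-b) ; (suc k) → cong merge (glued k) }
  where
  a b : Fin (suc c)
  a = label (proj₁ (ends zero))
  b = label (proj₂ (ends zero))

  merge : Fin (suc c) → Fin c
  -- The label `b` takes the value of `a`; punching `b` out then leaves one label fewer.
  merge x with b Fin.≟ x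
  ... | yes _  = punchOut (a≢b ∘ sym)
  ... | no b≢x = punchOut b≢x

  merge-b : merge b ≡ punchOut (a≢b ∘ sym)
  merge-b with b Fin.≟ b
  ... | yes _  = refl
  ... | no b≢b = contradiction refl b≢b

  merge-punchIn′ : ∀ {x} (x≢b : x ≢ b) → merge x ≡ punchOut (x≢b ∘ sym)
  merge-punchIn′ {x} x≢b with b Fin.≟ x
  ... | yes b≡x = contradiction (sym b≡x) x≢b
  ... | no b≢x  = Fin.punchOut-cong b refl

  merge-punchIn : ∀ i → merge (punchIn b i) ≡ i
  merge-punchIn i = trans (merge-punchIn′ (Fin.punchInᵢ≢i b i)) (Fin.punchOut-punchIn b)

-- Labels are constant along walks and each has a representative, so connectedness leaves at most
-- one label once all edges are merged.
connected⇒≤ : (G : Graph n e) → Graph.Connected G → n ℕ.≤ suc e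
connected⇒≤ {n} {e} G connected with merge-labels e (Graph.ends G)
... | c , n≤e+c , label , rep , label-rep , glued =
  ℕ.≤-trans n≤e+c (ℕ.≤-trans (ℕ.+-monoʳ-≤ e (at-most-one c same)) (ℕ.≤-reflexive (ℕ.+-comm e 1)))
  where
  adjacent : ∀ {a b} → Graph.Adjacent G a b → label a ≡ label b
  adjacent (k , inj₁ eq) = subst (λ (a , b) → label a ≡ label b) eq (glued k)
  adjacent (k , inj₂ eq) = sym (subst (λ (a , b) → label a ≡ label b) eq (glued k))

  walk : ∀ {a b} → Star (Graph.Adjacent G) a b → label a ≡ label b
  walk ε        = refl
  walk (s ◅ ss) = trans (adjacent s) (walk ss)

  same : ∀ i j → i ≡ j
  same i j = trans (sym (label-rep i)) (trans (walk (connected (rep i) (rep j))) (label-rep j))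

  at-most-one : ∀ c → (∀ (i j : Fin c) → i ≡ j) → c ℕ.≤ 1
  at-most-one zero          _    = z≤n
  at-most-one (suc zero)    _    = s≤s z≤n
  at-most-one (suc (suc c)) same with () ← same zero (suc zero)

-- Incidences between edges and a grid

-- On k i j says that edge k passes through the grid point (i , j), whereas
-- Horizontal k j and Vertical k i say that it is contained in a grid line.
record Incidence (n m e : ℕ) ℓ ℓ′ : Set (lsuc (ℓ ⊔ ℓ′)) where
  field
    On            : Fin e → Fin n → Fin m → Set ℓ
    Horizontal    : Fin e → Fin m → Set ℓ′
    Vertical      : Fin e → Fin n → Set ℓ′
    cover         : ∀ i j → ∃[ k ] On k i j
    same-row      : ∀ {k i i′ j} → On k i j → On k i′ j → i ≢ i′ → Horizontal k j
    same-column   : ∀ {k i j j′} → On k i j → On k i j′ → j ≢ j′ → Vertical k i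
    on-horizontal : ∀ {k i j j′} → Horizontal k j → On k i j′ → j ≡ j′
    on-vertical   : ∀ {k i i′ j} → Vertical k i → On k i′ j → i ≡ i′
    unique-row    : ∀ {k j j′} → Horizontal k j → Horizontal k j′ → j ≡ j′
    unique-column : ∀ {k i i′} → Vertical k i → Vertical k i′ → i ≡ i′
    exclusive     : ∀ {k i j} → Horizontal k j → ¬ Vertical k i
    horizontal?   : ∀ j → Dec (∃[ k ] Horizontal k j)
    vertical?     : ∀ i → Dec (∃[ k ] Vertical k i)
    all-rows      : (∀ j → ∃[ k ] Horizontal k j) → m ℕ.* 2 ℕ.≤ suc e
    all-columns   : (∀ i → ∃[ k ] Vertical k i) → n ℕ.* 2 ℕ.≤ suc e
    monotone      : ∀ k →
      (∀ {i i′ j j′} → On k i j → On k i′ j′ → i Fin.< i′ → j Fin.≤ j′) ⊎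
      (∀ {i i′ j j′} → On k i j → On k i′ j′ → i Fin.< i′ → j′ Fin.≤ j)

  FreeRow : Fin m → Set ℓ′
  FreeRow j = ¬ ∃ λ k → Horizontal k j

  FreeColumn : Fin n → Set ℓ′
  FreeColumn i = ¬ ∃ λ k → Vertical k i

  -- The segment from (x₁ , y₀) to (x , y) starts below and ends above the line
  -- through (x₀ , y₀) and (x₁ , y₁).
  Uncrossed : Set ℓ
  Uncrossed = ∀ {k k′ x₀ x₁ x y₀ y₁ y} → k ≢ k′ →
    On k x₀ y₀ → On k x₁ y₁ → On k′ x₁ y₀ → On k′ x y →
    x₀ Fin.< x₁ → y₀ Fin.< y₁ → x Fin.< x₁ →
    ¬ ((x ≡ x₀ × y₀ Fin.< y) ⊎ (x₀ Fin.≤ x × y₁ Fin.≤ y))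

-- Only `monotone` has to be rephrased: it compares columns first, so its transpose is a
-- contrapositive.
transpose : Incidence n m e ℓ ℓ′ → Incidence m n e ℓ ℓ′
transpose I = record
  { On            = λ k j i → On k i j
  ; Horizontal    = Vertical
  ; Vertical      = Horizontal
  ; cover         = λ j i → cover i j
  ; same-row      = same-column
  ; same-column   = same-row
  ; on-horizontal = on-vertical
  ; on-vertical   = on-horizontal
  ; unique-row    = unique-column
  ; unique-column = unique-row
  ; exclusive     = flip exclusive
  ; horizontal?   = vertical?
  ; vertical?     = horizontal?
  ; all-rows      = all-columns
  ; all-columns   = all-rows
  ; monotone      = λ k → Sum.map
      (λ up p q j<j′ → ℕ.≮⇒≥ λ i′<i → ℕ.<⇒≱ j<j′ (up q p i′<i))
      (λ down p q j<j′ → ℕ.≮⇒≥ λ i<i′ → ℕ.<⇒≱ j<j′ (down p q i<i′))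
      (monotone k)
  }
  where open Incidence I

-- Counting when a single row is free

module Thin (I : Incidence n (suc m) e ℓ ℓ′) (y : Fin (suc m))
  (free : Incidence.FreeRow I y) (only : ∀ {j} → Incidence.FreeRow I j → j ≡ y) where

  open Incidence I

  -- A column without an edge is represented by an edge through its point in the free row. These
  -- edges differ from column to column, as an edge with two points in that row would be contained
  -- in it.
  Claim : Fin m ⊎ Fin n → Fin e → Set (ℓ ⊔ ℓ′)
  Claim (inj₁ j) k = Level.Lift ℓ (Horizontal k (punchIn y j))
  Claim (inj₂ i) k = Vertical k i ⊎ On k i y

  total : ∀ x → ∃ (Claim x)
  total (inj₁ j) with horizontal? (punchIn y j)
  ... | yes (k , h) = k , Level.lift h
  ... | no none     = contradiction (only none) (Fin.punchInᵢ≢i y j)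
  total (inj₂ i) with vertical? i
  ... | yes (k , v) = k , inj₁ v
  ... | no _        = proj₁ (cover i y) , inj₂ (proj₂ (cover i y))

  disjoint : ∀ {j i k} → Claim (inj₁ j) k → ¬ Claim (inj₂ i) k
  disjoint (Level.lift h) (inj₁ v) = exclusive h v
  disjoint {j} (Level.lift h) (inj₂ p) = Fin.punchInᵢ≢i y j (on-horizontal h p)

  claimed-once : ∀ {x x′ k} → Claim x k → Claim x′ k → x ≡ x′
  claimed-once {inj₁ j} {inj₁ j′} (Level.lift h) (Level.lift h′) =
    cong inj₁ (Fin.punchIn-injective y j j′ (unique-row h h′))
  claimed-once {inj₁ _} {inj₂ _} h c = contradiction c (disjoint h)
  claimed-once {inj₂ _} {inj₁ _} c h = contradiction c (disjoint h)
  claimed-once {inj₂ _} {inj₂ _} (inj₁ v) (inj₁ v′) = cong inj₂ (unique-column v v′)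
  claimed-once {inj₂ _} {inj₂ _} (inj₁ v) (inj₂ p)  = cong inj₂ (on-vertical v p)
  claimed-once {inj₂ _} {inj₂ _} (inj₂ p) (inj₁ v)  = cong inj₂ (sym (on-vertical v p))
  claimed-once {inj₂ i} {inj₂ i′} (inj₂ p) (inj₂ p′) with i Fin.≟ i′
  ... | yes i≡i′ = cong inj₂ i≡i′
  ... | no i≢i′  = contradiction (_ , same-row p p′ i≢i′) free

  bound : m ℕ.+ n ℕ.≤ e
  bound = claims-≤ Fin.+↔⊎ ↔-refl Claim total claimed-once

-- Counting around the rectangle spanned by the free lines

module Thick (I : Incidence (2 ℕ.+ n) m e ℓ ℓ′)
  (x₀ x₁ : Fin (2 ℕ.+ n)) (y₀ y₁ : Fin m) (x₀<x₁ : x₀ Fin.< x₁) (y₀<y₁ : y₀ Fin.< y₁)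
  (free-x₀ : Incidence.FreeColumn I x₀) (free-x₁ : Incidence.FreeColumn I x₁)
  (free-y₀ : Incidence.FreeRow I y₀) (free-y₁ : Incidence.FreeRow I y₁)
  (between-x : ∀ {i} → Incidence.FreeColumn I i → x₀ Fin.≤ i × i Fin.≤ x₁)
  (between-y : ∀ {j} → Incidence.FreeRow I j → y₀ Fin.≤ j × j Fin.≤ y₁) where

  open Incidence I

  unique-x : ∀ {k i i′ j} → FreeRow j → On k i j → On k i′ j → i ≡ i′
  unique-x {i = i} {i′} free p p′ with i Fin.≟ i′
  ... | yes i≡i′ = i≡i′
  ... | no i≢i′  = contradiction (_ , same-row p p′ i≢i′) free

  unique-y : ∀ {k i j j′} → FreeColumn i → On k i j → On k i j′ → j ≡ j′
  unique-y {j = j} {j′} free p p′ with j Fin.≟ j′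
  ... | yes j≡j′ = j≡j′
  ... | no j≢j′  = contradiction (_ , same-column p p′ j≢j′) free

  x₀≢x₁ : x₀ ≢ x₁
  x₀≢x₁ = Fin.<⇒≢ x₀<x₁

  y₀≢y₁ : y₀ ≢ y₁
  y₀≢y₁ = Fin.<⇒≢ y₀<y₁

  -- The two extreme columns are left out because the claims of the rows already account for the
  -- left and right sides, corners included.
  inner : Fin n → Fin (2 ℕ.+ n)
  inner i = punchIn x₀ (punchIn (punchOut x₀≢x₁) i)

  inner-injective : Injective _≡_ _≡_ inner
  inner-injective = Fin.punchIn-injective _ _ _ ∘ Fin.punchIn-injective x₀ _ _

  inner≢x₀ : ∀ i → inner i ≢ x₀
  inner≢x₀ i = Fin.punchInᵢ≢i x₀ _

  inner≢x₁ : ∀ i → inner i ≢ x₁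
  inner≢x₁ i eq = Fin.punchInᵢ≢i (punchOut x₀≢x₁) i
    (Fin.punchIn-injective x₀ _ _ (trans eq (sym (Fin.punchIn-punchOut x₀≢x₁))))

  x₀<inner : ∀ {i} → FreeColumn (inner i) → x₀ Fin.< inner i
  x₀<inner {i} free = Fin.≤∧≢⇒< (proj₁ (between-x free)) (≢-sym (inner≢x₀ i))

  inner<x₁ : ∀ {i} → FreeColumn (inner i) → inner i Fin.< x₁
  inner<x₁ {i} free = Fin.≤∧≢⇒< (proj₂ (between-x free)) (inner≢x₁ i)

  side : Bool → Fin (2 ℕ.+ n)
  side false = x₀
  side true  = x₁

  free-side : ∀ β → FreeColumn (side β)
  free-side false = free-x₀
  free-side true  = free-x₁

  level : Bool → Fin m
  level false = y₀
  level true  = y₁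

  free-level : ∀ β → FreeRow (level β)
  free-level false = free-y₀
  free-level true  = free-y₁

  -- An oblique edge meets the boundary of the rectangle at most twice.  The
  -- first time it is on the left, or on the bottom or the top according as it
  -- rises or falls.
  Phase : Fin e → Bool → Bool → Set
  Phase k β γ = [ (λ _ → β ≡ γ) , (λ _ → β ≡ not γ) ]′ (monotone k)

  phase : ∀ k β → ∃ (Phase k β)
  phase k β with monotone k
  ... | inj₁ _ = β , refl
  ... | inj₂ _ = not β , sym (not-involutive β)

  phase-injective : ∀ k {β β′ γ} → Phase k β γ → Phase k β′ γ → β ≡ β′
  phase-injective k eq eq′ with monotone k
  ... | inj₁ _ = trans eq (sym eq′)
  ... | inj₂ _ = trans eq (sym eq′)

  -- A line that contains an edge takes both slots of that edge. A free line claims the edges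
  -- through its two boundary points: a point on the left or right side fixes the slot, whereas at
  -- the bottom or top `Phase` does.
  Claim : (Fin m ⊎ Fin n) × Bool → Fin e × Bool → Set (ℓ ⊔ ℓ′)
  Claim (inj₁ j , β) (k , γ) = β ≡ γ × (Horizontal k j ⊎ (FreeRow j × On k (side β) j))
  Claim (inj₂ i , β) (k , γ) = (β ≡ γ × Vertical k (inner i)) ⊎
    (FreeColumn (inner i) × On k (inner i) (level β) × Phase k β γ)

  total : ∀ x → ∃ (Claim x)
  total (inj₁ j , β) with horizontal? j
  ... | yes (k , h) = (k , β) , refl , inj₁ h
  ... | no free     =
    (proj₁ (cover (side β) j) , β) , refl , inj₂ (free , proj₂ (cover (side β) j))
  total (inj₂ i , β) with vertical? (inner i)
  ... | yes (k , v) = (k , β) , inj₁ (refl , v)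
  ... | no free     = let k , p = cover (inner i) (level β) ; γ , ph = phase k β in
    (k , γ) , inj₂ (free , p , ph)

  -- Monotonicity forces both points to the height `y₀` or `y₁`, and a free row contains no two
  -- points of one edge.
  one-per-phase : ∀ {k i j β γ} → FreeRow j → On k (side γ) j →
    FreeColumn (inner i) → On k (inner i) (level β) → ¬ Phase k β γ
  one-per-phase {k} {i} {j} {β} {γ} free p free′ p′ ph with monotone k
  one-per-phase {i = i} {γ = false} free p free′ p′ refl | inj₁ up =
    inner≢x₀ i (unique-x free-y₀ p′ (subst (On _ _)
      (Fin.≤-antisym (up p p′ (x₀<inner free′)) (proj₁ (between-y free))) p))
  one-per-phase {i = i} {γ = true} free p free′ p′ refl | inj₁ up =
    inner≢x₁ i (unique-x free-y₁ p′ (subst (On _ _)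
      (Fin.≤-antisym (proj₂ (between-y free)) (up p′ p (inner<x₁ free′))) p))
  one-per-phase {i = i} {γ = false} free p free′ p′ refl | inj₂ down =
    inner≢x₀ i (unique-x free-y₁ p′ (subst (On _ _)
      (Fin.≤-antisym (proj₂ (between-y free)) (down p p′ (x₀<inner free′))) p))
  one-per-phase {i = i} {γ = true} free p free′ p′ refl | inj₂ down =
    inner≢x₁ i (unique-x free-y₀ p′ (subst (On _ _)
      (Fin.≤-antisym (down p′ p (inner<x₁ free′)) (proj₁ (between-y free))) p))

  disjoint : ∀ {j i β β′ y} → Claim (inj₁ j , β) y → ¬ Claim (inj₂ i , β′) y
  disjoint (refl , inj₁ h) (inj₁ (_ , v)) = exclusive h v
  disjoint {β′ = β′} (refl , inj₁ h) (inj₂ (_ , p , _)) =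
    free-level β′ (_ , subst (Horizontal _) (on-horizontal h p) h)
  disjoint {β = β} (refl , inj₂ (_ , p)) (inj₁ (_ , v)) =
    free-side β (_ , subst (Vertical _) (on-vertical v p) v)
  disjoint {β = β} (refl , inj₂ (free , p)) (inj₂ (free′ , p′ , ph)) =
    one-per-phase free p free′ p′ ph

  claimed-once : ∀ {x x′ y} → Claim x y → Claim x′ y → x ≡ x′
  claimed-once {inj₁ _ , β} {inj₁ _ , _} (refl , c) (refl , c′) = cong (λ j → inj₁ j , β) (row c c′)
    where
    row : ∀ {k j j′} → Horizontal k j ⊎ (FreeRow j × On k (side β) j) →
          Horizontal k j′ ⊎ (FreeRow j′ × On k (side β) j′) → j ≡ j′
    row (inj₁ h)       (inj₁ h′)       = unique-row h h′
    row (inj₁ h)       (inj₂ (_ , p′)) = on-horizontal h p′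
    row (inj₂ (_ , p)) (inj₁ h′)       = sym (on-horizontal h′ p)
    row (inj₂ (_ , p)) (inj₂ (_ , p′)) = unique-y (free-side β) p p′
  claimed-once {inj₁ _ , _} {inj₂ _ , _} c c′ = contradiction c′ (disjoint c)
  claimed-once {inj₂ _ , _} {inj₁ _ , _} c c′ = contradiction c (disjoint c′)
  claimed-once {inj₂ _ , β} {inj₂ _ , _} (inj₁ (refl , v)) (inj₁ (refl , v′)) =
    cong (λ i → inj₂ i , β) (inner-injective (unique-column v v′))
  claimed-once {inj₂ _ , _} {inj₂ _ , _} (inj₁ (_ , v)) (inj₂ (free , p , _)) =
    contradiction (_ , subst (Vertical _) (on-vertical v p) v) free
  claimed-once {inj₂ _ , _} {inj₂ _ , _} (inj₂ (free , p , _)) (inj₁ (_ , v)) =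
    contradiction (_ , subst (Vertical _) (on-vertical v p) v) free
  claimed-once {inj₂ _ , β} {inj₂ _ , β′} {k , _} (inj₂ (_ , p , ph)) (inj₂ (_ , p′ , ph′))
    with refl ← phase-injective k ph ph′ =
    cong (λ i → inj₂ i , β) (inner-injective (unique-x (free-level β) p p′))

  -- `n` counts the inner columns only; this is where the 2 in n + m - 2 comes from.
  bound : m ℕ.+ n ℕ.≤ e
  bound = ℕ.*-cancelʳ-≤ _ _ 2 (claims-≤ (doubled Fin.+↔⊎) (doubled ↔-refl) Claim total claimed-once)

  claimed-or-bound : ∀ y → (∃[ x ] Claim x y) ⊎ m ℕ.+ n ℕ.< e
  claimed-or-bound y = Sum.map₂ (ℕ.*-cancelʳ-< 2 _ _)
    (claimed-or-< (doubled Fin.+↔⊎) (doubled ↔-refl) Claim total claimed-once y)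

  -- If every target is claimed, then the edge through (x₀ , y₀) leaves the
  -- rectangle on the right or at the top.  It separates (x₁ , y₀) or (x₀ , y₁)
  -- respectively from all points to which an oblique edge could lead.
  uncrossed-bound : Uncrossed → Incidence.Uncrossed (transpose I) → m ℕ.+ n ℕ.< e
  uncrossed-bound uncrossed uncrossedᵀ =
    -- The corner (x₀ , y₀) accounts for the slot `false` of `k`; a claim on the other slot supplies
    -- a point on the right or at the top.
    case claimed-or-bound (k , true) of λ
      { (inj₂ done) → done
      ; (inj₁ ((inj₁ j , _) , refl , inj₁ h)) →
          contradiction (k , subst (Horizontal k) (on-horizontal h p) h) free-y₀
      ; (inj₁ ((inj₁ j , _) , refl , inj₂ (free , q))) → right free q
      ; (inj₁ ((inj₂ i , _) , inj₁ (_ , v))) →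
          contradiction (on-vertical v p) (inner≢x₀ i)
      ; (inj₁ ((inj₂ i , false) , inj₂ (_ , q , _))) →
          contradiction (unique-x free-y₀ q p) (inner≢x₀ i)
      ; (inj₁ ((inj₂ i , true) , inj₂ (free , q , _))) → top free q
      }
    where
    k = proj₁ (cover x₀ y₀)
    p = proj₂ (cover x₀ y₀)

    right : ∀ {j} → FreeRow j → On k x₁ j → m ℕ.+ n ℕ.< e
    right {j} free q =
      -- The corner (x₁ , y₀) is on the right side and accounts for the slot `true` of `k′`.
      case claimed-or-bound (k′ , false) of λ
        { (inj₂ done) → done
        ; (inj₁ ((inj₁ j′ , _) , refl , inj₁ h)) →
            contradiction (k′ , subst (Horizontal k′) (on-horizontal h r) h) free-y₀
        ; (inj₁ ((inj₁ j′ , _) , refl , inj₂ (free′ , s))) →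
            contradiction (inj₁ (refl , Fin.≤∧≢⇒< (proj₁ (between-y free′))
                λ { refl → x₀≢x₁ (unique-x free-y₀ s r) }))
              (crossing s x₀<x₁)
        ; (inj₁ ((inj₂ i , _) , inj₁ (_ , v))) →
            contradiction (on-vertical v r) (inner≢x₁ i)
        ; (inj₁ ((inj₂ i , false) , inj₂ (_ , s , _))) →
            contradiction (unique-x free-y₀ s r) (inner≢x₁ i)
        ; (inj₁ ((inj₂ i , true) , inj₂ (free′ , s , _))) →
            contradiction (inj₂ (ℕ.<⇒≤ (x₀<inner free′) , proj₂ (between-y free)))
              (crossing s (inner<x₁ free′))
        }
      where
      k′ = proj₁ (cover x₁ y₀)
      r = proj₂ (cover x₁ y₀)

      crossing : ∀ {x y} → On k′ x y → x Fin.< x₁ → _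
      crossing s = uncrossed (λ k≡k′ → x₀≢x₁ (unique-x free-y₀ (subst (λ k → On k _ _) k≡k′ p) r))
        p q r s x₀<x₁ (Fin.≤∧≢⇒< (proj₁ (between-y free)) λ { refl → x₀≢x₁ (unique-x free-y₀ p q) })

    top : ∀ {i} → FreeColumn (inner i) → On k (inner i) y₁ → m ℕ.+ n ℕ.< e
    top {i} free q =
      -- The corner (x₀ , y₁) is on the left side and accounts for the slot `false` of `k′`.
      case claimed-or-bound (k′ , true) of λ
        { (inj₂ done) → done
        ; (inj₁ ((inj₁ j′ , _) , refl , inj₁ h)) →
            contradiction (k′ , subst (Horizontal k′) (on-horizontal h r) h) free-y₁
        ; (inj₁ ((inj₁ j′ , _) , refl , inj₂ (free′ , s))) →
            contradiction (inj₂ (proj₁ (between-y free′) , ℕ.<⇒≤ (inner<x₁ free)))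
              (crossing s (Fin.≤∧≢⇒< (proj₂ (between-y free′))
                λ { refl → x₀≢x₁ (unique-x free-y₁ r s) }))
        ; (inj₁ ((inj₂ i′ , _) , inj₁ (_ , v))) →
            contradiction (on-vertical v r) (inner≢x₀ i′)
        ; (inj₁ ((inj₂ i′ , true) , inj₂ (_ , s , _))) →
            contradiction (unique-x free-y₁ s r) (inner≢x₀ i′)
        ; (inj₁ ((inj₂ i′ , false) , inj₂ (free′ , s , _))) →
            contradiction (inj₁ (refl , x₀<inner free′)) (crossing s y₀<y₁)
        }
      where
      k′ = proj₁ (cover x₀ y₁)
      r = proj₂ (cover x₀ y₁)

      crossing : ∀ {x y} → On k′ x y → y Fin.< y₁ → _
      crossing s = uncrossedᵀ
        (λ k≡k′ → y₀≢y₁ (unique-y free-x₀ (subst (λ k → On k _ _) k≡k′ p) r))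
        p q r s y₀<y₁ (x₀<inner free)

-- The bound for an arbitrary incidence structure

2*⊓≤+ : ∀ n m → 2 ℕ.* (n ℕ.⊓ m) ℕ.≤ n ℕ.+ m
2*⊓≤+ n m = ℕ.+-mono-≤ (ℕ.m⊓n≤m n m) (ℕ.≤-trans (ℕ.≤-reflexive (ℕ.+-identityʳ _)) (ℕ.m⊓n≤n n m))

-- The weaker bound is kept together with its improvement, so that one case analysis serves trees
-- with and without crossings. Both orientations occur because the edge through the corner may leave
-- on the right or at the top.
EdgeBound : Incidence n m e ℓ ℓ′ → Set ℓ
EdgeBound {n} {m} {e} I = 2 ℕ.* (n ℕ.⊓ m) ℕ.≤ suc e ⊎
  (n ℕ.+ m ℕ.≤ 2 ℕ.+ e ×
   (Incidence.Uncrossed I → Incidence.Uncrossed (transpose I) → 2 ℕ.* (n ℕ.⊓ m) ℕ.≤ suc e))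

edge-bound : (I : Incidence n m e ℓ ℓ′) → EdgeBound I
edge-bound {n} {m} {e} I
  with extrema (λ i → ¬? (Incidence.vertical? I i)) | extrema (λ j → ¬? (Incidence.horizontal? I j))
... | inj₁ none | _ = inj₁ (ℕ.≤-trans (ℕ.*-monoʳ-≤ 2 (ℕ.m⊓n≤m n m)) (ℕ.≤-trans
        (ℕ.≤-reflexive (ℕ.*-comm 2 n))
        (all-columns λ i → decidable-stable (vertical? i) (none i))))
  where open Incidence I
... | inj₂ _ | inj₁ none = inj₁ (ℕ.≤-trans (ℕ.*-monoʳ-≤ 2 (ℕ.m⊓n≤n n m)) (ℕ.≤-trans
        (ℕ.≤-reflexive (ℕ.*-comm 2 m))
        (all-rows λ j → decidable-stable (horizontal? j) (none j))))
  where open Incidence I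
... | inj₂ (x₀ , x₁ , fx₀ , fx₁ , bx) | inj₂ (y₀ , y₁ , fy₀ , fy₁ , by) =
  cases I x₀ x₁ fx₀ fx₁ bx y₀ y₁ fy₀ fy₁ by
  where
  cases : ∀ {n m} (I : Incidence n m e _ _) (let open Incidence I)
    (x₀ x₁ : Fin n) → FreeColumn x₀ → FreeColumn x₁ →
    (∀ {i} → FreeColumn i → x₀ Fin.≤ i × i Fin.≤ x₁) →
    (y₀ y₁ : Fin m) → FreeRow y₀ → FreeRow y₁ →
    (∀ {j} → FreeRow j → y₀ Fin.≤ j × j Fin.≤ y₁) → EdgeBound I
  cases {zero} I () 
  cases {suc n} {zero} I _ _ _ _ _ ()
  cases {suc n} {suc m} I x₀ x₁ fx₀ fx₁ bx y₀ y₁ fy₀ fy₁ by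
    with x₀ Fin.≟ x₁ | y₀ Fin.≟ y₁
  -- With a single free column, the count for a single free row applies after transposition and
  -- loses only one line.
  ... | yes refl | _ = inj₁ (ℕ.≤-trans (2*⊓≤+ (suc n) (suc m)) (s≤s
    (Thin.bound (transpose I) x₀ fx₀ λ free → Fin.≤-antisym (proj₂ (bx free)) (proj₁ (bx free)))))
  ... | no _ | yes refl = inj₁ (ℕ.≤-trans (2*⊓≤+ (suc n) (suc m))
    (ℕ.≤-trans (ℕ.≤-reflexive (ℕ.+-comm (suc n) (suc m))) (s≤s
    (Thin.bound I y₀ fy₀ λ free → Fin.≤-antisym (proj₂ (by free)) (proj₁ (by free))))))
  cases {suc zero} {suc m} I zero zero _ _ _ _ _ _ _ _ | no x₀≢x₁ | no _ = contradiction refl x₀≢x₁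
  cases {suc (suc n)} {suc m} I x₀ x₁ fx₀ fx₁ bx y₀ y₁ fy₀ fy₁ by | no x₀≢x₁ | no y₀≢y₁ =
    inj₂ (subst (ℕ._≤ 2 ℕ.+ e) eq (s≤s (s≤s bound)) , λ u uᵀ →
      ℕ.≤-trans (2*⊓≤+ (2 ℕ.+ n) (suc m)) 
        (subst (ℕ._≤ suc e) eq (s≤s (uncrossed-bound (λ {k} → u {k}) (λ {k} → uᵀ {k})))))
    where
    open Thick I x₀ x₁ y₀ y₁
      (Fin.≤∧≢⇒< (ℕ.≤-trans (proj₁ (bx fx₀)) (proj₂ (bx fx₀))) x₀≢x₁)
      (Fin.≤∧≢⇒< (ℕ.≤-trans (proj₁ (by fy₀)) (proj₂ (by fy₀))) y₀≢y₁)
      fx₀ fx₁ fy₀ fy₁ bx by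
    eq : 2 ℕ.+ (suc m ℕ.+ n) ≡ 2 ℕ.+ n ℕ.+ suc m
    eq = cong (2 ℕ.+_) (ℕ.+-comm (suc m) n)

-- Arithmetic of the real numbers

module RealProperties {c ℓ₁ ℓ₂ ℓ₃} (ℝ : RealNumbers c ℓ₁ ℓ₂ ℓ₃) where

  module R = RealNumbers ℝ
  open RealNumbers ℝ hiding (refl; sym; trans; zero)
  open CommutativeRing commutativeRing using (ring; semiring; +-commutativeSemigroup)
  open RingProperties ring
    using (-0#≈0#; -‿+-comm; -‿anti-homo-+; [y-z]x≈yx-zx; x[y-z]≈xy-xz; -‿involutive)
  open SemiringMult semiring using (×-homo-+; ×1-homo-*)
  open CommutativeSemigroupProperties +-commutativeSemigroup using (interchange)

  fromNat-+ : ∀ a b → fromNat (a ℕ.+ b) ≈ fromNat a + fromNat b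
  fromNat-+ = ×-homo-+ 1#

  fromNat-* : ∀ a b → fromNat (a ℕ.* b) ≈ fromNat a * fromNat b
  fromNat-* = ×1-homo-*

  -- The pair (a , b) stands for the integer a − b.  The solver compares normal
  -- forms definitionally, so the coefficients have to be kept reduced.
  reduce : ℕ × ℕ → ℕ × ℕ
  reduce (suc a , suc b) = reduce (a , b)
  reduce p               = p

  differences : RawRing _ _
  differences = record
    { Carrier = ℕ × ℕ
    ; _≈_     = _≡_
    ; _+_     = λ (a , b) (c , d) → reduce (a ℕ.+ c , b ℕ.+ d)
    ; _*_     = λ (a , b) (c , d) → reduce (a ℕ.* c ℕ.+ b ℕ.* d , a ℕ.* d ℕ.+ b ℕ.* c)
    ; -_      = λ (a , b) → b , a
    ; 0#      = 0 , 0
    ; 1#      = 1 , 0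
    }

  -‿interchange : ∀ a b c d → (a + c) - (b + d) ≈ (a - b) + (c - d)
  -‿interchange a b c d =
    R.trans (+-congˡ (R.sym (-‿+-comm b d))) (interchange a c (- b) (- d))

  -‿swap : ∀ a b → b - a ≈ - (a - b)
  -‿swap a b = R.trans (+-congʳ (R.sym (-‿involutive b))) (R.sym (-‿anti-homo-+ a (- b)))

  -- The special cases let the solver recognise 0# and 1#.
  ⟦_⟧ : ℕ × ℕ → Carrier
  ⟦ 0 , 0 ⟧ = 0#
  ⟦ 1 , 0 ⟧ = 1#
  ⟦ a , b ⟧ = fromNat a - fromNat b

  ⟦⟧-difference : ∀ p → ⟦ p ⟧ ≈ fromNat (proj₁ p) - fromNat (proj₂ p)
  ⟦⟧-difference (0 , 0)           = R.sym (-‿inverseʳ _)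
  ⟦⟧-difference (0 , suc _)       = R.refl
  ⟦⟧-difference (1 , 0)           = R.sym
    (R.trans (+-cong (+-identityʳ 1#) -0#≈0#) (+-identityʳ 1#))
  ⟦⟧-difference (1 , suc _)       = R.refl
  ⟦⟧-difference (suc (suc _) , _) = R.refl

  ⟦reduce⟧ : ∀ a b → ⟦ reduce (a , b) ⟧ ≈ fromNat a - fromNat b
  ⟦reduce⟧ zero    b       = ⟦⟧-difference (0 , b)
  ⟦reduce⟧ (suc a) zero    = ⟦⟧-difference (suc a , 0)
  ⟦reduce⟧ (suc a) (suc b) = begin
    ⟦ reduce (a , b) ⟧                      ≈⟨ ⟦reduce⟧ a b ⟩
    fromNat a - fromNat b                   ≈⟨ +-identityˡ _ ⟨
    0# + (fromNat a - fromNat b)            ≈⟨ +-congʳ (-‿inverseʳ 1#) ⟨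
    (1# - 1#) + (fromNat a - fromNat b)     ≈⟨ -‿interchange _ _ _ _ ⟨
    (1# + fromNat a) - (1# + fromNat b)     ∎
    where open SetoidReasoning setoid

  differences⟶ℝ : differences -Raw-AlmostCommutative⟶ fromCommutativeRing commutativeRing
  differences⟶ℝ = record
    { ⟦_⟧    = ⟦_⟧
    ; +-homo = λ p@(a , b) q@(c , d) → begin
        ⟦ reduce (a ℕ.+ c , b ℕ.+ d) ⟧            ≈⟨ ⟦reduce⟧ (a ℕ.+ c) (b ℕ.+ d) ⟩
        fromNat (a ℕ.+ c) - fromNat (b ℕ.+ d)
          ≈⟨ +-cong (fromNat-+ a c) (-‿cong (fromNat-+ b d)) ⟩
        (fromNat a + fromNat c) - (fromNat b + fromNat d) ≈⟨ -‿interchange _ _ _ _ ⟩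
        (fromNat a - fromNat b) + (fromNat c - fromNat d)
          ≈⟨ +-cong (⟦⟧-difference p) (⟦⟧-difference q) ⟨
        ⟦ p ⟧ + ⟦ q ⟧                             ∎
    ; *-homo = λ p@(a , b) q@(c , d) → begin
        ⟦ reduce (a ℕ.* c ℕ.+ b ℕ.* d , a ℕ.* d ℕ.+ b ℕ.* c) ⟧
          ≈⟨ ⟦reduce⟧ (a ℕ.* c ℕ.+ b ℕ.* d) (a ℕ.* d ℕ.+ b ℕ.* c) ⟩
        fromNat (a ℕ.* c ℕ.+ b ℕ.* d) - fromNat (a ℕ.* d ℕ.+ b ℕ.* c)
          ≈⟨ +-cong (homo a c b d) (-‿cong (homo a d b c)) ⟩
        (fromNat a * fromNat c + fromNat b * fromNat d) -
        (fromNat a * fromNat d + fromNat b * fromNat c)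
          ≈⟨ -‿interchange _ _ _ _ ⟩
        (fromNat a * fromNat c - fromNat a * fromNat d) +
        (fromNat b * fromNat d - fromNat b * fromNat c)
          ≈⟨ +-cong (R.sym (x[y-z]≈xy-xz _ _ _))
               (R.trans (-‿swap _ _) (-‿cong (R.sym (x[y-z]≈xy-xz _ _ _)))) ⟩
        fromNat a * (fromNat c - fromNat d) - fromNat b * (fromNat c - fromNat d)
          ≈⟨ [y-z]x≈yx-zx _ _ _ ⟨
        (fromNat a - fromNat b) * (fromNat c - fromNat d)
          ≈⟨ *-cong (⟦⟧-difference p) (⟦⟧-difference q) ⟨
        ⟦ p ⟧ * ⟦ q ⟧ ∎
    ; -‿homo = λ p@(a , b) → R.trans (⟦⟧-difference (b , a))
        (R.trans (-‿swap _ _) (-‿cong (R.sym (⟦⟧-difference p))))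
    ; 0-homo = R.refl
    ; 1-homo = R.refl
    }
    where
    open SetoidReasoning setoid
    homo : ∀ a c b d → fromNat (a ℕ.* c ℕ.+ b ℕ.* d) ≈
                       fromNat a * fromNat c + fromNat b * fromNat d
    homo a c b d = R.trans (fromNat-+ (a ℕ.* c) (b ℕ.* d))
      (+-cong (fromNat-* a c) (fromNat-* b d))

  coefficient≟ : WeaklyDecidable (Induced-equivalence differences⟶ℝ)
  coefficient≟ p q with ≡-dec ℕ._≟_ ℕ._≟_ p q
  ... | no _     = nothing
  ... | yes refl = just R.refl

  open RingSolver differences (fromCommutativeRing commutativeRing) differences⟶ℝ coefficient≟
    public using (Polynomial; solve; _:=_; _:+_; _:*_; _:-_; :-_; con)

  :0 :1 : ∀ {n} → Polynomial n
  :0 = con (0 , 0)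
  :1 = con (1 , 0)

  -- Order, signs and inverses

  open IsStrictPartialOrder isStrictPartialOrder public
    using () renaming (irrefl to <-irrefl; trans to <-trans)

  <-resp : ∀ {x x′ y y′} → x ≈ x′ → y ≈ y′ → x < y → x′ < y′
  <-resp x≈x′ y≈y′ x<y =
    proj₁ <-resp-≈ y≈y′ (proj₂ <-resp-≈ x≈x′ x<y)
    where open IsStrictPartialOrder isStrictPartialOrder

  <⇒≤ : ∀ {x y} → x < y → x ≤ y
  <⇒≤ x<y y<x = <-irrefl R.refl (<-trans x<y y<x)

  ≤-resp : ∀ {x x′ y y′} → x ≈ x′ → y ≈ y′ → x ≤ y → x′ ≤ y′
  ≤-resp x≈x′ y≈y′ x≤y y′<x′ = x≤y (<-resp (R.sym y≈y′) (R.sym x≈x′) y′<x′)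

  ≈⇒≤ : ∀ {x y} → x ≈ y → x ≤ y
  ≈⇒≤ x≈y y<x = <-irrefl (R.sym x≈y) y<x

  -- Both inequalities are negations; together they refute apartness, which is tight.
  ≤-antisym : ∀ {x y} → x ≤ y → y ≤ x → x ≈ y
  ≤-antisym x≤y y≤x = proj₁ (tight _ _)
    λ x#y → [ y≤x , x≤y ]′ (Equivalence.to (#⇔<⊎> _ _) x#y)

  <⇒0<- : ∀ {x y} → x < y → 0# < y - x
  <⇒0<- {x} {y} x<y = <-resp (-‿inverseˡ x) (+-comm (- x) y) (+-monoʳ-< (- x) x<y)

  0<-⇒< : ∀ {x y} → 0# < y - x → x < y
  0<-⇒< {x} {y} 0<y-x = <-resp (+-identityʳ x)
    (solve 2 (λ x y → x :+ (y :- x) := y) R.refl x y) (+-monoʳ-< x 0<y-x)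

  ≤⇒0≤- : ∀ {x y} → x ≤ y → 0# ≤ y - x
  ≤⇒0≤- {x} {y} x≤y y-x<0 = x≤y (<-resp
    (solve 2 (λ x y → x :+ (y :- x) := y) R.refl x y) (+-identityʳ x) (+-monoʳ-< x y-x<0))

  0≤-⇒≤ : ∀ {x y} → 0# ≤ y - x → x ≤ y
  0≤-⇒≤ {x} {y} 0≤y-x y<x = 0≤y-x (<-resp (+-comm (- x) y) (-‿inverseˡ x) (+-monoʳ-< (- x) y<x))

  0<-- : ∀ {x} → x < 0# → 0# < - x
  0<-- {x} x<0 = <-resp R.refl (+-identityˡ (- x)) (<⇒0<- x<0)

  0<+ : ∀ {x y} → 0# < x → 0# < y → 0# < x + y
  0<+ {x} 0<x 0<y = <-trans 0<x (<-resp (+-identityʳ x) R.refl (+-monoʳ-< x 0<y))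

  0<1 : 0# < 1#
  0<1 = [ (λ 1<0 → <-resp R.refl (solve 0 ((:- :1) :* (:- :1) := :1) R.refl)
            (*-pos (0<-- 1<0) (0<-- 1<0)))
        , id ]′ (Equivalence.to (#⇔<⊎> _ _) (HeytingProperties.1#0 heytingCommutativeRing))

  -- Distinguishing signs is possible only under a double negation. This suffices for proving `_≤_`,
  -- itself a negation.
  ¬¬-nonneg : ∀ {x} → 0# ≤ x → ¬ ¬ (0# < x ⊎ x ≈ 0#)
  ¬¬-nonneg 0≤x neither =
    neither (inj₂ (≤-antisym (neither ∘ inj₁) 0≤x))

  ¬¬-trichotomy : ∀ x → ¬ ¬ (x < 0# ⊎ x ≈ 0# ⊎ 0# < x)
  ¬¬-trichotomy x none = none (inj₂ (inj₁ (≤-antisym (none ∘ inj₂ ∘ inj₂) (none ∘ inj₁))))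

  0≤+ : ∀ {x y} → 0# ≤ x → 0# ≤ y → 0# ≤ x + y
  0≤+ {x} {y} 0≤x 0≤y x+y<0 = ¬¬-nonneg 0≤x λ
    { (inj₁ 0<x) → 0≤y (<-trans (<-resp (+-identityˡ y) (+-comm y x)
        (<-resp (+-comm y 0#) R.refl (+-monoʳ-< y 0<x))) x+y<0)
    ; (inj₂ x≈0) → 0≤y (<-resp (R.trans (+-congʳ x≈0) (+-identityˡ y)) R.refl x+y<0) }

  ≤-trans : ∀ {x y z} → x ≤ y → y ≤ z → x ≤ z
  ≤-trans {x} {y} {z} x≤y y≤z = 0≤-⇒≤ (≤-resp R.refl
    (solve 3 (λ x y z → (y :- x) :+ (z :- y) := z :- x) R.refl x y z)
    (0≤+ (≤⇒0≤- x≤y) (≤⇒0≤- y≤z)))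

  0≤* : ∀ {x y} → 0# ≤ x → 0# ≤ y → 0# ≤ x * y
  0≤* {x} {y} 0≤x 0≤y xy<0 = ¬¬-nonneg 0≤x λ
    { (inj₂ x≈0) → <-irrefl (R.trans (*-congʳ x≈0) (zeroˡ y)) xy<0
    ; (inj₁ 0<x) → ¬¬-nonneg 0≤y λ
      { (inj₂ y≈0) → <-irrefl (R.trans (*-congˡ y≈0) (zeroʳ x)) xy<0
      ; (inj₁ 0<y) → <⇒≤ (*-pos 0<x 0<y) xy<0 } }

  0≤² : ∀ x → 0# ≤ x * x
  0≤² x x²<0 = ¬¬-trichotomy x λ
    { (inj₁ x<0) → <⇒≤ (<-resp R.refl (solve 1 (λ x → (:- x) :* (:- x) := x :* x) R.refl x)
        (*-pos (0<-- x<0) (0<-- x<0))) x²<0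
    ; (inj₂ (inj₁ x≈0)) → <-irrefl (R.trans (*-congʳ x≈0) (zeroˡ x)) x²<0
    ; (inj₂ (inj₂ 0<x)) → <⇒≤ (*-pos 0<x 0<x) x²<0 }

  -- If `y` were apart from zero, multiplying by its inverse would give x ≈ 0; tightness turns this
  -- refutation into an equation.
  zero-product : ∀ {x y} → x * y ≈ 0# → ¬ x ≈ 0# → y ≈ 0#
  zero-product {x} {y} xy≈0 x≉0 = proj₁ (tight _ _) λ y#0 →
    let y⁻¹ , _ , yy⁻¹≈1 = #⇒invertible y#0 in x≉0 (begin
      x                      ≈⟨ *-identityʳ x ⟨
      x * 1#                 ≈⟨ *-congˡ yy⁻¹≈1 ⟨
      x * ((y - 0#) * y⁻¹)
        ≈⟨ solve 3 (λ x y y⁻¹ → x :* ((y :- :0) :* y⁻¹) := x :* y :* y⁻¹) R.refl x y y⁻¹ ⟩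
      x * y * y⁻¹            ≈⟨ *-congʳ xy≈0 ⟩
      0# * y⁻¹               ≈⟨ zeroˡ y⁻¹ ⟩
      0#                     ∎)
    where open SetoidReasoning setoid

  positive-inverse : ∀ {x} → 0# < x → ∃[ x⁻¹ ] 0# < x⁻¹ × x * x⁻¹ ≈ 1#
  positive-inverse {x} 0<x
    with x⁻¹ , _ , eq ← #⇒invertible (Equivalence.from (#⇔<⊎> x 0#) (inj₂ 0<x)) =
    -- A negative inverse would make `x * (- x⁻¹)`, which is -1, positive.
    x⁻¹ , [ (λ x⁻¹<0 → contradiction (<-resp R.refl
              (R.trans (solve 2 (λ x y → x :* (:- y) := :- (x :* y)) R.refl x x⁻¹) (-‿cong xx⁻¹≈1))
              (*-pos 0<x (0<-- x⁻¹<0)))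
              λ 0<-1 → <-irrefl (solve 0 (:0 := :- :1 :+ :1) R.refl) (0<+ 0<-1 0<1))
          , id ]′ (Equivalence.to (#⇔<⊎> x⁻¹ 0#) x⁻¹#0) , xx⁻¹≈1
    where
    xx⁻¹≈1 : x * x⁻¹ ≈ 1#
    xx⁻¹≈1 = R.trans (*-congʳ (solve 1 (λ x → x := x :- :0) R.refl x)) eq
    x⁻¹#0 : x⁻¹ # 0#
    x⁻¹#0 = HeytingProperties.invertibleˡ⇒# heytingCommutativeRing
      (x , R.trans (*-congˡ (solve 1 (λ x → x :- :0 := x) R.refl x⁻¹)) xx⁻¹≈1)

  0<*-cancel : ∀ {x y} → 0# < y → 0# < x * y → 0# < x
  0<*-cancel {x} {y} 0<y 0<xy with y⁻¹ , 0<y⁻¹ , yy⁻¹≈1 ← positive-inverse 0<y =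
    <-resp R.refl (R.trans (*-assoc x y y⁻¹) (R.trans (*-congˡ yy⁻¹≈1) (*-identityʳ x)))
      (*-pos 0<xy 0<y⁻¹)

  fromNat-mono-< : ∀ {a b} → a ℕ.< b → fromNat a < fromNat b
  fromNat-mono-< {zero}  {suc zero}    _         = <-resp R.refl (R.sym (+-identityʳ 1#)) 0<1
  fromNat-mono-< {zero}  {suc (suc b)} _         = 0<+ 0<1 (fromNat-mono-< {zero} {suc b} (s≤s z≤n))
  fromNat-mono-< {suc a} {suc b}       (s≤s a<b) = +-monoʳ-< 1# (fromNat-mono-< a<b)

  fromNat-mono-≤ : ∀ {a b} → a ℕ.≤ b → fromNat a ≤ fromNat b
  fromNat-mono-≤ a≤b with ℕ.m≤n⇒m<n∨m≡n a≤b
  ... | inj₁ a<b  = <⇒≤ (fromNat-mono-< a<b)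
  ... | inj₂ refl = ≈⇒≤ R.refl

  fromNat-cancel-≤ : ∀ {a b} → fromNat a ≤ fromNat b → a ℕ.≤ b
  fromNat-cancel-≤ a≤b = ℕ.≮⇒≥ (a≤b ∘ fromNat-mono-<)

  fromNat-injective : ∀ {a b} → fromNat a ≈ fromNat b → a ≡ b
  fromNat-injective a≈b =
    ℕ.≤-antisym (fromNat-cancel-≤ (≈⇒≤ a≈b)) (fromNat-cancel-≤ (≈⇒≤ (R.sym a≈b)))

-- Segments

module Segments {c ℓ₁ ℓ₂ ℓ₃} (ℝ : RealNumbers c ℓ₁ ℓ₂ ℓ₃) where

  open RealProperties ℝ
  open RealNumbers ℝ hiding (refl; sym; trans; zero)

  lerp : ∀ t a b → (1# - t) * a + t * b ≈ a + t * (b - a)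
  lerp = solve 3 (λ t a b → (:1 :- t) :* a :+ t :* b := a :+ t :* (b :- a)) R.refl

  onSegment : ∀ {a₁ a₂ b₁ b₂ p₁ p₂} t → 0# ≤ t → 0# ≤ 1# - t →
    p₁ ≈ a₁ + t * (b₁ - a₁) → p₂ ≈ a₂ + t * (b₂ - a₂) →
    OnSegment ℝ (a₁ , a₂) (b₁ , b₂) (p₁ , p₂)
  onSegment t 0≤t t≤1 eq₁ eq₂ =
    t , 0≤t , 0≤-⇒≤ t≤1 , R.trans eq₁ (R.sym (lerp _ _ _)) , R.trans eq₂ (R.sym (lerp _ _ _))

  start : ∀ a b → OnSegment ℝ a b a
  start a b = onSegment 0# (≈⇒≤ R.refl) (≤⇒0≤- (<⇒≤ 0<1)) (stay _ _) (stay _ _)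
    where
    stay : ∀ x y → x ≈ x + 0# * (y - x)
    stay = solve 2 (λ x y → x := x :+ :0 :* (y :- x)) R.refl

  end : ∀ a b → OnSegment ℝ a b b
  end a b = onSegment 1# (<⇒≤ 0<1) (≈⇒≤ (R.sym (-‿inverseʳ 1#))) (arrive _ _) (arrive _ _)
    where
    arrive : ∀ x y → y ≈ x + 1# * (y - x)
    arrive = solve 2 (λ x y → y := x :+ :1 :* (y :- x)) R.refl

  swap-segment : ∀ {a b p} → OnSegment ℝ a b p → OnSegment ℝ (swap a) (swap b) (swap p)
  swap-segment (t , 0≤t , t≤1 , eq₁ , eq₂) = t , 0≤t , t≤1 , eq₂ , eq₁

  module _ {a₁ a₂ b₁ b₂ : Carrier} where

    -- This reduces collinearity, slope and betweenness on a segment to identities in the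
    -- parameters.
    displacement : ∀ {p₁ p₂ q₁ q₂}
      ((s , _) : OnSegment ℝ (a₁ , a₂) (b₁ , b₂) (p₁ , p₂))
      ((t , _) : OnSegment ℝ (a₁ , a₂) (b₁ , b₂) (q₁ , q₂)) →
      (q₁ - p₁ ≈ (t - s) * (b₁ - a₁)) × (q₂ - p₂ ≈ (t - s) * (b₂ - a₂))
    displacement (s , _ , _ , p₁≈ , p₂≈) (t , _ , _ , q₁≈ , q₂≈) =
      R.trans (+-cong q₁≈ (-‿cong p₁≈)) (factor t s a₁ b₁) ,
      R.trans (+-cong q₂≈ (-‿cong p₂≈)) (factor t s a₂ b₂)
      where
      factor : ∀ t s a b → (1# - t) * a + t * b - ((1# - s) * a + s * b) ≈ (t - s) * (b - a)
      factor = solve 4 (λ t s a b → (:1 :- t) :* a :+ t :* b :- ((:1 :- s) :* a :+ s :* b) :=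
        (t :- s) :* (b :- a)) R.refl

    collinear : ∀ {p₁ p₂ q₁ q₂ r₁ r₂} → OnSegment ℝ (a₁ , a₂) (b₁ , b₂) (p₁ , p₂) →
      OnSegment ℝ (a₁ , a₂) (b₁ , b₂) (q₁ , q₂) → OnSegment ℝ (a₁ , a₂) (b₁ , b₂) (r₁ , r₂) →
      (r₂ - p₂) * (q₁ - p₁) ≈ (r₁ - p₁) * (q₂ - p₂)
    collinear p@(s , _) q@(t , _) r@(u , _) = R.trans
      (*-cong (proj₂ (displacement p r)) (proj₁ (displacement p q)))
      (R.trans (exchange (u - s) (t - s) (b₁ - a₁) (b₂ - a₂))
        (R.sym (*-cong (proj₁ (displacement p r)) (proj₂ (displacement p q)))))
      where
      exchange : ∀ u v x y → u * y * (v * x) ≈ u * x * (v * y)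
      exchange = solve 4 (λ u v x y → u :* y :* (v :* x) := u :* x :* (v :* y)) R.refl

    -- Different abscissas exclude equal parameters, so the vanishing height difference
    -- `(t - s) * (b₂ - a₂)` forces b₂ ≈ a₂.
    levelled : ∀ {p₁ p₂ q₁ q₂} → OnSegment ℝ (a₁ , a₂) (b₁ , b₂) (p₁ , p₂) →
      OnSegment ℝ (a₁ , a₂) (b₁ , b₂) (q₁ , q₂) → p₂ ≈ q₂ → ¬ p₁ ≈ q₁ →
      (a₂ ≈ p₂) × (b₂ ≈ p₂)
    levelled {p₁} {p₂} {q₁} p@(s , _ , _ , _ , p₂≈) q@(t , _) p₂≈q₂ p₁≉q₁ =
      R.sym p₂≈a₂ , R.trans b₂≈a₂ (R.sym p₂≈a₂)
      where
      rise : b₂ - a₂ ≈ 0#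
      rise = zero-product
        (R.trans (R.sym (proj₂ (displacement p q)))
          (R.trans (+-congʳ (R.sym p₂≈q₂)) (-‿inverseʳ p₂)))
        λ t-s≈0 → p₁≉q₁ (R.sym (begin
          q₁                   ≈⟨ solve 2 (λ p q → q := p :+ (q :- p)) R.refl p₁ q₁ ⟩
          p₁ + (q₁ - p₁)       ≈⟨ +-congˡ (proj₁ (displacement p q)) ⟩
          p₁ + (t - s) * (b₁ - a₁) ≈⟨ +-congˡ (*-congʳ t-s≈0) ⟩
          p₁ + 0# * (b₁ - a₁)  ≈⟨ solve 2 (λ p d → p :+ :0 :* d := p) R.refl p₁ (b₁ - a₁) ⟩
          p₁                   ∎))
        where open SetoidReasoning setoid

      b₂≈a₂ : b₂ ≈ a₂
      b₂≈a₂ = R.trans (solve 2 (λ a b → b := a :+ (b :- a)) R.refl a₂ b₂)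
        (R.trans (+-congˡ rise) (+-identityʳ a₂))

      p₂≈a₂ : p₂ ≈ a₂
      p₂≈a₂ = R.trans p₂≈ (R.trans (lerp s a₂ b₂) (R.trans (+-congˡ (*-congˡ rise))
        (solve 2 (λ a s → a :+ s :* :0 := a) R.refl a₂ s)))

    stays-level : ∀ {p₁ p₂ y} → OnSegment ℝ (a₁ , a₂) (b₁ , b₂) (p₁ , p₂) →
      a₂ ≈ y → b₂ ≈ y → p₂ ≈ y
    stays-level (s , _ , _ , _ , p₂≈) a₂≈y b₂≈y = R.trans p₂≈ (R.trans
      (+-cong (*-congˡ a₂≈y) (*-congˡ b₂≈y))
      (solve 2 (λ s y → (:1 :- s) :* y :+ s :* y := y) R.refl s _))

    -- The sign of the product replaces that of the slope, which a vertical segment lacks; passing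
    -- to two points of the segment multiplies it by a square.
    product-of-displacements : ∀ {p₁ p₂ q₁ q₂}
      (p@(s , _) : OnSegment ℝ (a₁ , a₂) (b₁ , b₂) (p₁ , p₂))
      (q@(t , _) : OnSegment ℝ (a₁ , a₂) (b₁ , b₂) (q₁ , q₂)) →
      (q₁ - p₁) * (q₂ - p₂) ≈ (t - s) * (t - s) * ((b₁ - a₁) * (b₂ - a₂))
    product-of-displacements p q = R.trans
      (*-cong (proj₁ (displacement p q)) (proj₂ (displacement p q)))
      (solve 3 (λ u x y → u :* x :* (u :* y) := u :* u :* (x :* y)) R.refl _ _ _)

    rising : 0# < (b₁ - a₁) * (b₂ - a₂) → ∀ {p₁ p₂ q₁ q₂} →
      OnSegment ℝ (a₁ , a₂) (b₁ , b₂) (p₁ , p₂) → OnSegment ℝ (a₁ , a₂) (b₁ , b₂) (q₁ , q₂) →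
      p₁ < q₁ → p₂ ≤ q₂
    rising 0<d p q p₁<q₁ q₂<p₂ =
      0≤* (0≤² _) (<⇒≤ 0<d) (<-resp (product-of-displacements p q) R.refl
        (0<-⇒< (<-resp R.refl
          (solve 4 (λ p₁ p₂ q₁ q₂ → (q₁ :- p₁) :* (p₂ :- q₂) := :0 :- (q₁ :- p₁) :* (q₂ :- p₂))
            R.refl _ _ _ _)
          (*-pos (<⇒0<- p₁<q₁) (<⇒0<- q₂<p₂)))))

    falling : (b₁ - a₁) * (b₂ - a₂) ≤ 0# → ∀ {p₁ p₂ q₁ q₂} →
      OnSegment ℝ (a₁ , a₂) (b₁ , b₂) (p₁ , p₂) → OnSegment ℝ (a₁ , a₂) (b₁ , b₂) (q₁ , q₂) →
      p₁ < q₁ → q₂ ≤ p₂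
    falling d≤0 p q p₁<q₁ p₂<q₂ =
      0≤* (0≤² _) (≤⇒0≤- d≤0) (<-resp
        (R.trans (-‿cong (product-of-displacements p q))
          (solve 2 (λ u d → :- (u :* u :* d) := u :* u :* (:0 :- d)) R.refl _ _))
        R.refl (0<-⇒< (<-resp R.refl
          (solve 1 (λ z → z := :0 :- (:- z)) R.refl _)
          (*-pos (<⇒0<- p₁<q₁) (<⇒0<- p₂<q₂)))))

    convex : ∀ {p₁ p₂ q₁ q₂ r} → OnSegment ℝ (a₁ , a₂) (b₁ , b₂) (p₁ , p₂) →
      OnSegment ℝ (a₁ , a₂) (b₁ , b₂) (q₁ , q₂) → OnSegment ℝ (p₁ , p₂) (q₁ , q₂) r →
      OnSegment ℝ (a₁ , a₂) (b₁ , b₂) r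
    convex (s , 0≤s , s≤1 , p₁≈ , p₂≈) (t , 0≤t , t≤1 , q₁≈ , q₂≈) (u , 0≤u , u≤1 , r₁≈ , r₂≈) =
      (1# - u) * s + u * t ,
      0≤+ (0≤* (≤⇒0≤- u≤1) 0≤s) (0≤* 0≤u 0≤t) ,
      0≤-⇒≤ (≤-resp R.refl
        (solve 3 (λ s t u → (:1 :- u) :* (:1 :- s) :+ u :* (:1 :- t) :=
          :1 :- ((:1 :- u) :* s :+ u :* t)) R.refl s t u)
        (0≤+ (0≤* (≤⇒0≤- u≤1) (≤⇒0≤- s≤1)) (0≤* 0≤u (≤⇒0≤- t≤1)))) ,
      combine r₁≈ p₁≈ q₁≈ , combine r₂≈ p₂≈ q₂≈
      where
      combine : ∀ {r p q a b} → r ≈ (1# - u) * p + u * q →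
        p ≈ (1# - s) * a + s * b → q ≈ (1# - t) * a + t * b →
        r ≈ (1# - ((1# - u) * s + u * t)) * a + ((1# - u) * s + u * t) * b
      combine r≈ p≈ q≈ = R.trans r≈ (R.trans (+-cong (*-congˡ p≈) (*-congˡ q≈))
        (solve 5 (λ s t u a b →
          (:1 :- u) :* ((:1 :- s) :* a :+ s :* b) :+ u :* ((:1 :- t) :* a :+ t :* b) :=
          (:1 :- ((:1 :- u) :* s :+ u :* t)) :* a :+ ((:1 :- u) :* s :+ u :* t) :* b)
          R.refl s t u _ _))

    -- With both parameters on the same side of `u`, the product (v₁ - p₁)(q₁ - v₁) is minus a
    -- product of nonnegative factors.
    between-params : ∀ {p₁ p₂ q₁ q₂ v₁ v₂}
      ((s , _) : OnSegment ℝ (a₁ , a₂) (b₁ , b₂) (p₁ , p₂))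
      ((t , _) : OnSegment ℝ (a₁ , a₂) (b₁ , b₂) (q₁ , q₂))
      ((u , _) : OnSegment ℝ (a₁ , a₂) (b₁ , b₂) (v₁ , v₂)) →
      0# ≤ (s - u) * (t - u) → p₁ < v₁ → ¬ v₁ < q₁
    between-params {p₁} {q₁ = q₁} {v₁ = v₁} p@(s , _) q@(t , _) v@(u , _) 0≤st p₁<v₁ v₁<q₁ =
      0≤* 0≤st (0≤² (b₁ - a₁)) (0<-⇒< (<-resp R.refl (begin
        (v₁ - p₁) * (q₁ - v₁)
          ≈⟨ *-cong (proj₁ (displacement p v)) (proj₁ (displacement v q)) ⟩
        (u - s) * (b₁ - a₁) * ((t - u) * (b₁ - a₁))
          ≈⟨ solve 4 (λ s t u d → (u :- s) :* d :* ((t :- u) :* d) :=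
               :0 :- (s :- u) :* (t :- u) :* (d :* d)) R.refl s t u (b₁ - a₁) ⟩
        0# - (s - u) * (t - u) * ((b₁ - a₁) * (b₁ - a₁)) ∎)
        (*-pos (<⇒0<- p₁<v₁) (<⇒0<- v₁<q₁))))
      where open SetoidReasoning setoid

    start-extremal : ∀ {p₁ p₂ q₁ q₂} → OnSegment ℝ (a₁ , a₂) (b₁ , b₂) (p₁ , p₂) →
      OnSegment ℝ (a₁ , a₂) (b₁ , b₂) (q₁ , q₂) → p₁ < a₁ → ¬ a₁ < q₁
    start-extremal p@(s , 0≤s , _) q@(t , 0≤t , _) = between-params p q (start _ _)
      (0≤* (≤⇒0≤- 0≤s) (≤⇒0≤- 0≤t))

    end-extremal : ∀ {p₁ p₂ q₁ q₂} → OnSegment ℝ (a₁ , a₂) (b₁ , b₂) (p₁ , p₂) →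
      OnSegment ℝ (a₁ , a₂) (b₁ , b₂) (q₁ , q₂) → p₁ < b₁ → ¬ b₁ < q₁
    end-extremal p@(s , _ , s≤1 , _) q@(t , _ , t≤1 , _) = between-params p q (end _ _)
      (≤-resp R.refl (solve 2 (λ s t → (:1 :- s) :* (:1 :- t) := (s :- :1) :* (t :- :1)) R.refl s t)
        (0≤* (≤⇒0≤- s≤1) (≤⇒0≤- t≤1)))

  -- The segments from (x₀ , y₀) to (x₁ , y₁) and from (x₁ , y₀) to (x , y).
  module Crossing {x₀ x₁ x y₀ y₁ y : Carrier}
    (x₀<x₁ : x₀ < x₁) (y₀<y₁ : y₀ < y₁) (x<x₁ : x < x₁) (y₀<y : y₀ < y) where

    -- The cross product of the two direction vectors, and by Cramer's rule the common denominator
    -- of the parameters of the intersection.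
    determinant : Carrier
    determinant = (y - y₀) * (x₁ - x₀) + (x₁ - x) * (y₁ - y₀)

    0<determinant : 0# < determinant
    0<determinant = 0<+ (*-pos (<⇒0<- y₀<y) (<⇒0<- x₀<x₁)) (*-pos (<⇒0<- x<x₁) (<⇒0<- y₀<y₁))

    -- The hypotheses put `v` on both lines, not necessarily on the segments. Cramer's rule makes v₁
    -- - x₀ and x₁ - v₁ quotients of positive products.
    strictly-between : ∀ {v₁ v₂} →
      (v₂ - y₀) * (x₁ - x₀) ≈ (v₁ - x₀) * (y₁ - y₀) →
      (v₂ - y₀) * (x - x₁) ≈ (v₁ - x₁) * (y - y₀) → x₀ < v₁ × v₁ < x₁
    strictly-between {v₁} {v₂} on-first on-second =
      0<-⇒< (0<*-cancel 0<determinant (<-resp R.refl (R.sym from-left)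
        (*-pos (*-pos (<⇒0<- y₀<y) (<⇒0<- x₀<x₁)) (<⇒0<- x₀<x₁)))) ,
      0<-⇒< (0<*-cancel 0<determinant (<-resp R.refl (R.sym from-right)
        (*-pos (*-pos (<⇒0<- x<x₁) (<⇒0<- y₀<y₁)) (<⇒0<- x₀<x₁))))
      where
      open SetoidReasoning setoid

      from-left : (v₁ - x₀) * determinant ≈ (y - y₀) * (x₁ - x₀) * (x₁ - x₀)
      from-left = begin
        (v₁ - x₀) * determinant
          ≈⟨ solve 6 (λ x₀ x₁ x v W Y → (v :- x₀) :* (W :* (x₁ :- x₀) :+ (x₁ :- x) :* Y) :=
               (v :- x₀) :* W :* (x₁ :- x₀) :+ (x₁ :- x) :* ((v :- x₀) :* Y))
               R.refl x₀ x₁ x v₁ (y - y₀) (y₁ - y₀) ⟩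
        (v₁ - x₀) * (y - y₀) * (x₁ - x₀) + (x₁ - x) * ((v₁ - x₀) * (y₁ - y₀))
          ≈⟨ +-congˡ (*-congˡ on-first) ⟨
        (v₁ - x₀) * (y - y₀) * (x₁ - x₀) + (x₁ - x) * ((v₂ - y₀) * (x₁ - x₀))
          ≈⟨ solve 6 (λ x₀ x₁ x v V W →
               (v :- x₀) :* W :* (x₁ :- x₀) :+ (x₁ :- x) :* (V :* (x₁ :- x₀)) :=
               (v :- x₀) :* W :* (x₁ :- x₀) :- V :* (x :- x₁) :* (x₁ :- x₀))
               R.refl x₀ x₁ x v₁ (v₂ - y₀) (y - y₀) ⟩
        (v₁ - x₀) * (y - y₀) * (x₁ - x₀) - (v₂ - y₀) * (x - x₁) * (x₁ - x₀)
          ≈⟨ +-congˡ (-‿cong (*-congʳ on-second)) ⟩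
        (v₁ - x₀) * (y - y₀) * (x₁ - x₀) - (v₁ - x₁) * (y - y₀) * (x₁ - x₀)
          ≈⟨ solve 4 (λ x₀ x₁ v W →
               (v :- x₀) :* W :* (x₁ :- x₀) :- (v :- x₁) :* W :* (x₁ :- x₀) :=
               W :* (x₁ :- x₀) :* (x₁ :- x₀)) R.refl x₀ x₁ v₁ (y - y₀) ⟩
        (y - y₀) * (x₁ - x₀) * (x₁ - x₀) ∎

      from-right : (x₁ - v₁) * determinant ≈ (x₁ - x) * (y₁ - y₀) * (x₁ - x₀)
      from-right = begin
        (x₁ - v₁) * determinant
          ≈⟨ solve 4 (λ x₀ x₁ v D → (x₁ :- v) :* D := (x₁ :- x₀) :* D :- (v :- x₀) :* D)
               R.refl x₀ x₁ v₁ determinant ⟩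
        (x₁ - x₀) * determinant - (v₁ - x₀) * determinant
          ≈⟨ +-congˡ (-‿cong from-left) ⟩
        (x₁ - x₀) * determinant - (y - y₀) * (x₁ - x₀) * (x₁ - x₀)
          ≈⟨ solve 4 (λ X W Z Y → X :* (W :* X :+ Z :* Y) :- W :* X :* X := Z :* Y :* X)
               R.refl (x₁ - x₀) (y - y₀) (x₁ - x) (y₁ - y₀) ⟩
        (x₁ - x) * (y₁ - y₀) * (x₁ - x₀) ∎

    -- The hypothesis says that (x , y) lies strictly above the first line; it keeps the parameter
    -- on the second segment below 1.
    intersection : (x - x₀) * (y₁ - y₀) < (y - y₀) * (x₁ - x₀) →
      ∃[ v ] OnSegment ℝ (x₀ , y₀) (x₁ , y₁) v × OnSegment ℝ (x₁ , y₀) (x , y) v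
    intersection above =
      (x₀ + σ * X , y₀ + σ * Y) ,
      onSegment σ (<⇒≤ (*-pos (*-pos 0<W 0<X) 0<D⁻¹))
        (<⇒≤ (<-resp R.refl complement-σ (*-pos (*-pos 0<Z 0<Y) 0<D⁻¹)))
        R.refl R.refl ,
      onSegment τ (<⇒≤ (*-pos (*-pos 0<X 0<Y) 0<D⁻¹))
        (<⇒≤ (<-resp R.refl complement-τ (*-pos (<⇒0<- above) 0<D⁻¹)))
        x-coordinate (+-congˡ y-coordinate)
      where
      open SetoidReasoning setoid

      D⁻¹     = proj₁ (positive-inverse 0<determinant)
      0<D⁻¹   = proj₁ (proj₂ (positive-inverse 0<determinant))
      DD⁻¹≈1  = proj₂ (proj₂ (positive-inverse 0<determinant))

      W = y - y₀
      X = x₁ - x₀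
      Y = y₁ - y₀
      Z = x₁ - x

      0<W = <⇒0<- y₀<y
      0<X = <⇒0<- x₀<x₁
      0<Y = <⇒0<- y₀<y₁
      0<Z = <⇒0<- x<x₁

      σ = W * X * D⁻¹
      τ = X * Y * D⁻¹

      complement-σ : Z * Y * D⁻¹ ≈ 1# - σ
      complement-σ = begin
        Z * Y * D⁻¹
          ≈⟨ solve 5 (λ W X Y Z i → Z :* Y :* i := (W :* X :+ Z :* Y) :* i :- W :* X :* i)
               R.refl W X Y Z D⁻¹ ⟩
        determinant * D⁻¹ - σ  ≈⟨ +-congʳ DD⁻¹≈1 ⟩
        1# - σ                 ∎

      complement-τ : (W * X - (x - x₀) * Y) * D⁻¹ ≈ 1# - τ
      complement-τ = begin
        (W * X - (x - x₀) * Y) * D⁻¹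
          ≈⟨ solve 6 (λ x₀ x₁ x W Y i → (W :* (x₁ :- x₀) :- (x :- x₀) :* Y) :* i :=
               (W :* (x₁ :- x₀) :+ (x₁ :- x) :* Y) :* i :- (x₁ :- x₀) :* Y :* i)
               R.refl x₀ x₁ x W Y D⁻¹ ⟩
        determinant * D⁻¹ - τ  ≈⟨ +-congʳ DD⁻¹≈1 ⟩
        1# - τ                 ∎

      x-coordinate : x₀ + σ * X ≈ x₁ + τ * (x - x₁)
      x-coordinate = begin
        x₀ + σ * X
          ≈⟨ solve 6 (λ x₀ x₁ x W Y i → x₀ :+ W :* (x₁ :- x₀) :* i :* (x₁ :- x₀) :=
               x₀ :+ ((W :* (x₁ :- x₀) :+ (x₁ :- x) :* Y) :* i) :* (x₁ :- x₀)
               :+ (x₁ :- x₀) :* Y :* i :* (x :- x₁)) R.refl x₀ x₁ x W Y D⁻¹ ⟩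
        x₀ + determinant * D⁻¹ * X + τ * (x - x₁)
          ≈⟨ +-congʳ (+-congˡ (*-congʳ DD⁻¹≈1)) ⟩
        x₀ + 1# * X + τ * (x - x₁)
          ≈⟨ +-congʳ (solve 2 (λ x₀ x₁ → x₀ :+ :1 :* (x₁ :- x₀) := x₁) R.refl x₀ x₁) ⟩
        x₁ + τ * (x - x₁) ∎

      y-coordinate : σ * Y ≈ τ * W
      y-coordinate = solve 4 (λ W X Y i → W :* X :* i :* Y := X :* Y :* i :* W) R.refl W X Y D⁻¹

    steep-left : x ≈ x₀ → (x - x₀) * (y₁ - y₀) < (y - y₀) * (x₁ - x₀)
    steep-left x≈x₀ = <-resp
      (R.sym (R.trans (*-congʳ (R.trans (+-congʳ x≈x₀) (-‿inverseʳ x₀))) (zeroˡ _)))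
      R.refl (*-pos (<⇒0<- y₀<y) (<⇒0<- x₀<x₁))

    steep-top : y₁ < y ⊎ y₁ ≈ y → (x - x₀) * (y₁ - y₀) < (y - y₀) * (x₁ - x₀)
    steep-top (inj₁ y₁<y) = 0<-⇒< (<-resp R.refl
      (solve 6 (λ x₀ x₁ x y₀ y₁ y → (y :- y₁) :* (x₁ :- x₀) :+ (y₁ :- y₀) :* (x₁ :- x) :=
        (y :- y₀) :* (x₁ :- x₀) :- (x :- x₀) :* (y₁ :- y₀)) R.refl x₀ x₁ x y₀ y₁ y)
      (0<+ (*-pos (<⇒0<- y₁<y) (<⇒0<- x₀<x₁)) (*-pos (<⇒0<- y₀<y₁) (<⇒0<- x<x₁))))
    steep-top (inj₂ y₁≈y) = 0<-⇒< (<-resp R.refl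
      (R.trans
        (solve 4 (λ x₀ x₁ x Y → Y :* (x₁ :- x) := Y :* (x₁ :- x₀) :- (x :- x₀) :* Y)
          R.refl x₀ x₁ x (y₁ - y₀))
        (+-congʳ (*-congʳ (+-congʳ y₁≈y))))
      (*-pos (<⇒0<- y₀<y₁) (<⇒0<- x<x₁)))

    -- A common endpoint would lie on both lines, hence strictly between two points of the first
    -- edge, but an end of a segment is never between two of its points.
    no-shared-endpoint : ∀ {a b a′ b′ v} →
      OnSegment ℝ a b (x₀ , y₀) → OnSegment ℝ a b (x₁ , y₁) →
      OnSegment ℝ a′ b′ (x₁ , y₀) → OnSegment ℝ a′ b′ (x , y) →
      v ≡ a ⊎ v ≡ b → ¬ OnSegment ℝ a′ b′ v
    no-shared-endpoint {a} {b} p q r s (inj₁ refl) v =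
      start-extremal p q (proj₁ between) (proj₂ between)
      where
      between : x₀ < proj₁ a × proj₁ a < x₁
      between = strictly-between (collinear p q (start a b)) (collinear r s v)
    no-shared-endpoint {a} {b} p q r s (inj₂ refl) v =
      end-extremal p q (proj₁ between) (proj₂ between)
      where
      between : x₀ < proj₁ b × proj₁ b < x₁
      between = strictly-between (collinear p q (end a b)) (collinear r s v)

-- Lower bounds for geometric trees

-- Finiteness allows the double negations to be sequenced one index at a time.
¬¬-Π : ∀ {ℓ n} {P : Pred (Fin n) ℓ} → (∀ i → ¬ ¬ P i) → ¬ ¬ (∀ i → P i)
¬¬-Π = Fin.sequence (RawMonad.rawApplicative ¬¬-Monad)

module LowerBound {c ℓ₁ ℓ₂ ℓ₃} (ℝ : RealNumbers c ℓ₁ ℓ₂ ℓ₃) {e : ℕ} (T : GeometricTree ℝ e) where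

  open RealProperties ℝ
  open Segments ℝ
  open RealNumbers ℝ hiding (refl; sym; trans; zero)
  open GeometricTree T hiding (ends; distinct)

  open Graph graph using (ends; ordered)

  source target : Fin e → Fin v
  source k = proj₁ (ends k)
  target k = proj₂ (ends k)

  source≢target : ∀ k → source k ≢ target k
  source≢target k = Fin.<⇒≢ (ordered k)

  endpoint-on : ∀ {a k} → IsEndpoint a k → OnEdge k (position a)
  endpoint-on (inj₁ refl) = start _ _
  endpoint-on (inj₂ refl) = end _ _

  SharedEndpoint : Fin e → Fin e → Set
  SharedEndpoint k k′ = ∃[ a ] IsEndpoint a k × IsEndpoint a k′

  -- Weaker than `Noncrossing`, as the shared endpoint need not be the point of intersection. This
  -- form also covers trees with at most two edges.
  IntersectionsShared : Set _
  IntersectionsShared = ∀ k k′ → k ≢ k′ → ∀ p → OnEdge k p → OnEdge k′ p → SharedEndpoint k k′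

  vertex-bound : v ℕ.≤ suc e
  vertex-bound = connected⇒≤ graph connected

  two-edges-share : e ℕ.≤ 2 → IntersectionsShared
  two-edges-share e≤2 k k′ _ _ _ _ =
    -- At most three vertices are available for four ends, and the two ends of one edge are
    -- distinct.
    shared (Fin.pigeonhole (s≤s (ℕ.≤-trans vertex-bound (s≤s e≤2))) ends′)
    where
    ends′ : Fin 4 → Fin v
    ends′ zero                   = source k
    ends′ (suc zero)             = target k
    ends′ (suc (suc zero))       = source k′
    ends′ (suc (suc (suc zero))) = target k′

    shared : (∃₂ λ i j → i Fin.< j × ends′ i ≡ ends′ j) → SharedEndpoint k k′
    shared (zero , suc zero , _ , eq) = contradiction eq (source≢target k)
    shared (zero , suc (suc zero) , _ , eq) = _ , inj₁ refl , inj₁ eq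
    shared (zero , suc (suc (suc zero)) , _ , eq) = _ , inj₁ refl , inj₂ eq
    shared (suc zero , suc zero , s≤s () , eq)
    shared (suc zero , suc (suc zero) , _ , eq) = _ , inj₂ refl , inj₁ eq
    shared (suc zero , suc (suc (suc zero)) , _ , eq) = _ , inj₂ refl , inj₂ eq
    shared (suc (suc zero) , suc zero , s≤s () , eq)
    shared (suc (suc zero) , suc (suc zero) , s≤s (s≤s ()) , eq)
    shared (suc (suc zero) , suc (suc (suc zero)) , _ , eq) = contradiction eq (source≢target k′)
    shared (suc (suc (suc zero)) , suc zero , s≤s () , eq)
    shared (suc (suc (suc zero)) , suc (suc zero) , s≤s (s≤s ()) , eq)
    shared (suc (suc (suc zero)) , suc (suc (suc zero)) , s≤s (s≤s (s≤s ())) , eq)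

  module Grid (n m : ℕ) (covers : Covers (V ℝ n m)) where

    coordinate : ∀ {n} → Fin n → Carrier
    coordinate i = fromNat (suc (toℕ i))

    coordinate-mono-< : ∀ {n} {i i′ : Fin n} → i Fin.< i′ → coordinate i < coordinate i′
    coordinate-mono-< i<i′ = fromNat-mono-< (s≤s i<i′)

    coordinate-cancel-≤ : ∀ {n} {i i′ : Fin n} → coordinate i ≤ coordinate i′ → i Fin.≤ i′
    coordinate-cancel-≤ i≤i′ = ℕ.≤-pred (fromNat-cancel-≤ i≤i′)

    coordinate-injective : ∀ {n} {i i′ : Fin n} → coordinate i ≈ coordinate i′ → i ≡ i′
    coordinate-injective eq = Fin.toℕ-injective (ℕ.suc-injective (fromNat-injective eq))

    On : Fin e → Fin n → Fin m → Set _
    On k i j = OnEdge k (coordinate i , coordinate j)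

    Horizontal : Fin e → Fin m → Set _
    Horizontal k j = proj₂ (position (source k)) ≈ coordinate j ×
                     proj₂ (position (target k)) ≈ coordinate j

    Vertical : Fin e → Fin n → Set _
    Vertical k i = proj₁ (position (source k)) ≈ coordinate i ×
                   proj₁ (position (target k)) ≈ coordinate i

    endpoint : Fin e → Bool → Fin v
    endpoint k false = source k
    endpoint k true  = target k

    -- Ends on different grid lines differ in `value`, so the chosen edges have pairwise different
    -- ends, all among at most e + 1 vertices.
    disjoint-edges : ∀ {a} (value : Fin v → Carrier) (edge : Fin a → Fin e) →
      (∀ i β → value (endpoint (edge i) β) ≈ coordinate i) → a ℕ.* 2 ℕ.≤ suc e
    disjoint-edges value edge constant = ℕ.≤-trans
      (claims-≤ (doubled ↔-refl) ↔-refl (λ (i , β) a → endpoint (edge i) β ≡ a)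
        (λ _ → _ , refl) λ {x} {x′} eq eq′ → distinct-ends x x′ (trans eq (sym eq′)))
      vertex-bound
      where
      same-end : ∀ k β β′ → endpoint k β ≡ endpoint k β′ → β ≡ β′
      same-end k false false _  = refl
      same-end k false true  eq = contradiction eq (source≢target k)
      same-end k true  false eq = contradiction (sym eq) (source≢target k)
      same-end k true  true  _  = refl

      distinct-ends : ∀ x x′ →
        endpoint (edge (proj₁ x)) (proj₂ x) ≡ endpoint (edge (proj₁ x′)) (proj₂ x′) → x ≡ x′
      distinct-ends (i , β) (i′ , β′) eq
        with refl ← coordinate-injective {i = i} {i′} (R.trans (R.sym (constant i β))
                      (R.trans (R.reflexive (cong value eq)) (constant i′ β′))) =
        cong (i ,_) (same-end (edge i) β β′ eq)

    Monotone : Fin e → Set _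
    Monotone k =
      (∀ {i i′ j j′} → On k i j → On k i′ j′ → i Fin.< i′ → j Fin.≤ j′) ⊎
      (∀ {i i′ j j′} → On k i j → On k i′ j′ → i Fin.< i′ → j′ Fin.≤ j)

    Classified : Set _
    Classified = (∀ j → Dec (∃[ k ] Horizontal k j)) ×
                 (∀ i → Dec (∃[ k ] Vertical k i)) ×
                 (∀ k → Monotone k)

    ¬¬-classified : ¬ ¬ Classified
    ¬¬-classified none =
      ¬¬-Π (λ _ → ¬¬-excluded-middle) λ horizontal? →
      ¬¬-Π (λ _ → ¬¬-excluded-middle) λ vertical? →
      ¬¬-Π (λ k → ¬¬-map slope ¬¬-excluded-middle) λ monotone →
      none (horizontal? , vertical? , monotone)
      where
      slope : ∀ {k} → Dec (_ < _) → Monotone k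
      slope (yes 0<d) = inj₁ λ p q i<i′ →
        coordinate-cancel-≤ (rising 0<d p q (coordinate-mono-< i<i′))
      slope (no d≤0)  = inj₂ λ p q i<i′ →
        coordinate-cancel-≤ (falling d≤0 p q (coordinate-mono-< i<i′))

    incidence : Classified → Incidence n m e _ _
    incidence (horizontal? , vertical? , monotone) = record
      { On            = On
      ; Horizontal    = Horizontal
      ; Vertical      = Vertical
      ; cover         = λ i j → covers _ (suc (toℕ i) , suc (toℕ j) ,
          (s≤s z≤n , Fin.toℕ<n i) , (s≤s z≤n , Fin.toℕ<n j) , R.refl , R.refl)
      ; same-row      = λ p q i≢i′ → levelled p q R.refl (i≢i′ ∘ coordinate-injective)
      ; same-column   = λ p q j≢j′ →
          levelled (swap-segment p) (swap-segment q) R.refl (j≢j′ ∘ coordinate-injective)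
      ; on-horizontal = λ (s≈ , t≈) p → coordinate-injective (R.sym (stays-level p s≈ t≈))
      ; on-vertical   = λ (s≈ , t≈) p →
          coordinate-injective (R.sym (stays-level (swap-segment p) s≈ t≈))
      ; unique-row    = λ (s≈ , _) (s≈′ , _) → coordinate-injective (R.trans (R.sym s≈) s≈′)
      ; unique-column = λ (s≈ , _) (s≈′ , _) → coordinate-injective (R.trans (R.sym s≈) s≈′)
      ; exclusive     = λ {k} (sy≈ , ty≈) (sx≈ , tx≈) → source≢target k
          (GeometricTree.distinct T (R.trans sx≈ (R.sym tx≈) , R.trans sy≈ (R.sym ty≈)))
      ; horizontal?   = horizontal?
      ; vertical?     = vertical?
      ; all-rows      = λ rows → disjoint-edges (proj₂ ∘ position) (proj₁ ∘ rows)
          λ { j false → proj₁ (proj₂ (rows j)) ; j true → proj₂ (proj₂ (rows j)) }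
      ; all-columns   = λ columns → disjoint-edges (proj₁ ∘ position) (proj₁ ∘ columns)
          λ { i false → proj₁ (proj₂ (columns i)) ; i true → proj₂ (proj₂ (columns i)) }
      ; monotone      = monotone
      }

    module _ (σ : Point ℝ → Point ℝ)
      (σ-segment : ∀ {a b p} → OnSegment ℝ a b p → OnSegment ℝ (σ a) (σ b) (σ p)) where

      OnImage : Fin e → Point ℝ → Set _
      OnImage k = OnSegment ℝ (σ (position (source k))) (σ (position (target k)))

      -- Taking `σ` as the identity or as `swap` serves both orientations. By convexity the
      -- intersection lies on both edges, which would therefore have to share an endpoint.
      no-crossing : ∀ {k k′} → (∀ p → OnImage k p → OnImage k′ p → SharedEndpoint k k′) →
        ∀ {a b} {x₀ x₁ x : Fin a} {y₀ y₁ y : Fin b} →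
        OnImage k (coordinate x₀ , coordinate y₀) → OnImage k (coordinate x₁ , coordinate y₁) →
        OnImage k′ (coordinate x₁ , coordinate y₀) → OnImage k′ (coordinate x , coordinate y) →
        x₀ Fin.< x₁ → y₀ Fin.< y₁ → x Fin.< x₁ →
        ¬ ((x ≡ x₀ × y₀ Fin.< y) ⊎ (x₀ Fin.≤ x × y₁ Fin.≤ y))
      no-crossing {k} {k′} shared {x₀ = x₀} {x₁} {x} {y₀} {y₁} {y} p q r s x₀<x₁ y₀<y₁ x<x₁ above =
        meet (intersection (steep above))
        where
        y₀<y : (x ≡ x₀ × y₀ Fin.< y) ⊎ (x₀ Fin.≤ x × y₁ Fin.≤ y) → y₀ Fin.< y
        y₀<y (inj₁ (_ , y₀<y)) = y₀<y
        y₀<y (inj₂ (_ , y₁≤y)) = ℕ.<-≤-trans y₀<y₁ y₁≤y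

        open Crossing (coordinate-mono-< x₀<x₁) (coordinate-mono-< y₀<y₁)
          (coordinate-mono-< x<x₁) (coordinate-mono-< (y₀<y above))

        steep : (x ≡ x₀ × y₀ Fin.< y) ⊎ (x₀ Fin.≤ x × y₁ Fin.≤ y) →
          (coordinate x - coordinate x₀) * (coordinate y₁ - coordinate y₀) <
          (coordinate y - coordinate y₀) * (coordinate x₁ - coordinate x₀)
        steep (inj₁ (refl , _)) = steep-left R.refl
        steep (inj₂ (_ , y₁≤y)) = steep-top (Sum.map (fromNat-mono-< ∘ s≤s)
          (R.reflexive ∘ cong (fromNat ∘ suc)) (ℕ.m≤n⇒m<n∨m≡n y₁≤y))

        meet : ¬ (∃[ v ]
          OnSegment ℝ (coordinate x₀ , coordinate y₀) (coordinate x₁ , coordinate y₁) v ×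
          OnSegment ℝ (coordinate x₁ , coordinate y₀) (coordinate x , coordinate y) v)
        meet (v , on , on′) =
          let a , end , end′ = shared v (convex p q on) (convex r s on′)
          in no-shared-endpoint p q r s
            (Sum.map (cong (σ ∘ position)) (cong (σ ∘ position)) end) (σ-segment (endpoint-on end′))

    module _ (shared : IntersectionsShared) (κ : Classified) where

      uncrossed : Incidence.Uncrossed (incidence κ)
      uncrossed k≢k′ = no-crossing id id (shared _ _ k≢k′)

      uncrossedᵀ : Incidence.Uncrossed (transpose (incidence κ))
      uncrossedᵀ k≢k′ p q r s = no-crossing swap swap-segment
        (λ v on on′ → shared _ _ k≢k′ (swap v) (swap-segment on) (swap-segment on′))
        (swap-segment p) (swap-segment q) (swap-segment r) (swap-segment s)

    -- The statement is decidable, which discharges the double negation on `Classified`.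
    edge-count : 2 ℕ.* (n ℕ.⊓ m) ℕ.≤ suc e ⊎ n ℕ.+ m ℕ.≤ 2 ℕ.+ e
    edge-count = decidable-stable (_ ℕ.≤? _ ⊎-dec _ ℕ.≤? _)
      (¬¬-map (Sum.map₂ proj₁ ∘ edge-bound ∘ incidence) ¬¬-classified)

    edge-count-shared : IntersectionsShared → 2 ℕ.* (n ℕ.⊓ m) ℕ.≤ suc e
    edge-count-shared shared = decidable-stable (_ ℕ.≤? _)
      (¬¬-map (λ κ → [ id , (λ (_ , bound) → bound (λ {k} → uncrossed shared κ {k})
        (λ {k} → uncrossedᵀ shared κ {k})) ]′ (edge-bound (incidence κ))) ¬¬-classified)

-- Trees given by parent functions

maximum : ∀ {n} (f : Fin (suc n) → ℕ) → ∃[ i ] ∀ j → f j ℕ.≤ f i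
maximum {zero} f = zero , λ { zero → ℕ.≤-refl }
maximum {suc n} f with maximum (f ∘ suc)
... | i , largest with ℕ.≤-total (f zero) (f (suc i))
... | inj₁ f0≤ = suc i , λ { zero → f0≤ ; (suc j) → largest j }
... | inj₂ ≤f0 = zero , λ { zero → ℕ.≤-refl ; (suc j) → ℕ.≤-trans (largest j) ≤f0 }

module ParentTree {e : ℕ} (parent : Fin e → Fin (suc e)) (parent≤ : ∀ k → parent k Fin.≤ k) where

  graph : Graph (suc e) e
  graph = record
    { ends      = λ k → parent k , suc k
    ; ordered   = s≤s ∘ parent≤
    ; injective = Fin.suc-injective ∘ cong proj₂
    }

  open Graph graph using (Adjacent; Connected; Cycle; Acyclic)

  Adjacent-sym : ∀ {a b} → Adjacent a b → Adjacent b a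
  Adjacent-sym (k , eq) = k , Sum.swap eq

  connected : Connected
  connected a b = descend (toℕ a) a ℕ.≤-refl ◅◅ reverse Adjacent-sym (descend (toℕ b) b ℕ.≤-refl)
    where
    descend : ∀ h a → toℕ a ℕ.≤ h → Star Adjacent a zero
    descend h       zero    _         = ε
    descend (suc h) (suc k) (s≤s k≤h) =
      (k , inj₂ refl) ◅ descend h (parent k) (ℕ.≤-trans (parent≤ k) k≤h)

  smaller-neighbour : ∀ {a b} → Adjacent a b → b Fin.≤ a → ∃[ k ] a ≡ suc k × b ≡ parent k
  smaller-neighbour (k , inj₁ refl) b≤a = contradiction (s≤s (parent≤ k)) (ℕ.≤⇒≯ b≤a)
  smaller-neighbour (k , inj₂ refl) _   = k , refl , refl

  -- The largest vertex of a cycle would have two smaller neighbours, but only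
  -- its parent is one.
  acyclic : Acyclic
  acyclic cycle with maximum (toℕ ∘ Cycle.w cycle)
  ... | i , largest = no-two-neighbours (neighbours i)
    where
    open Cycle cycle

    neighbours : ∀ i → ∃₂ λ j j′ → j ≢ j′ × Adjacent (w i) (w j) × Adjacent (w i) (w j′)
    neighbours zero = suc zero , fromℕ (2 ℕ.+ l) , (λ ()) , step zero , Adjacent-sym closing
    neighbours (suc i) with view i
    ... | ‵fromℕ     = inject₁ i , zero , (λ ()) , Adjacent-sym (step i) , closing
    ... | ‵inject₁ j = inject₁ i , suc (suc j) , apart , Adjacent-sym (step i) , step (suc j)
      where
      apart : inject₁ (inject₁ j) ≢ suc (suc j)
      apart eq = ℕ.<⇒≢ (ℕ.m≤n⇒m≤1+n (ℕ.≤-refl)) (trans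
        (sym (trans (Fin.toℕ-inject₁ (inject₁ j)) (Fin.toℕ-inject₁ j))) (cong toℕ eq))

    no-two-neighbours : ¬ (∃₂ λ j j′ → j ≢ j′ × Adjacent (w i) (w j) × Adjacent (w i) (w j′))
    no-two-neighbours (j , j′ , j≢j′ , a , a′)
      with k , wi≡ , wj≡ ← smaller-neighbour a (largest j)
         | k′ , wi≡′ , wj′≡ ← smaller-neighbour a′ (largest j′) =
      j≢j′ (Cycle.distinct cycle (trans wj≡ (trans
        (cong parent (Fin.suc-injective (trans (sym wi≡) wi≡′))) (sym wj′≡))))

↑-elim : ∀ m {n ℓ} (P : Fin (m ℕ.+ n) → Set ℓ) →
  (∀ i → P (i ↑ˡ n)) → (∀ j → P (m ↑ʳ j)) → ∀ k → P k
↑-elim m {n} P left right k =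
  subst P (Fin.join-splitAt m n k) (both (splitAt m k))
  where
  both : ∀ s → P (Fin.join m n s)
  both (inj₁ i) = left i
  both (inj₂ j) = right j

-- Both orientations occur along the spiral; the strict inequality keeps the denominator b - a of
-- the segment parameter positive.
Between : ℕ → ℕ → ℕ → Set
Between a b x = (a ℕ.< b × a ℕ.≤ x × x ℕ.≤ b) ⊎ (b ℕ.< a × b ℕ.≤ x × x ℕ.≤ a)

-- Trees with vertices at natural coordinates

module GridTrees {c ℓ₁ ℓ₂ ℓ₃} (ℝ : RealNumbers c ℓ₁ ℓ₂ ℓ₃) where

  open RealProperties ℝ
  open Segments ℝ
  open RealNumbers ℝ hiding (refl; sym; trans; zero)

  point : ℕ × ℕ → Point ℝ
  point (x , y) = fromNat x , fromNat y

  point-injective : ∀ {p q} → _≈ₚ_ ℝ (point p) (point q) → p ≡ q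
  point-injective (x≈ , y≈) = cong₂ _,_ (fromNat-injective x≈) (fromNat-injective y≈)

  reverse-segment : ∀ {a b p} → OnSegment ℝ a b p → OnSegment ℝ b a p
  reverse-segment (t , 0≤t , t≤1 , eq₁ , eq₂) = onSegment (1# - t) (≤⇒0≤- t≤1)
    (≤-resp R.refl (solve 1 (λ t → t := :1 :- (:1 :- t)) R.refl t) 0≤t)
    (R.trans eq₁ (flipped _ _)) (R.trans eq₂ (flipped _ _))
    where
    flipped : ∀ a b → (1# - t) * a + t * b ≈ b + (1# - t) * (a - b)
    flipped = solve 3 (λ t a b → (:1 :- t) :* a :+ t :* b := b :+ (:1 :- t) :* (a :- b)) R.refl t

  -- With the parameter u / (w + u), clearing denominators turns incidence into equations between
  -- natural numbers.
  weighted-mean : ∀ ((a₁ , a₂) (b₁ , b₂) (p₁ , p₂) : ℕ × ℕ) u w → 0 ℕ.< w ℕ.+ u →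
    (w ℕ.+ u) ℕ.* p₁ ≡ w ℕ.* a₁ ℕ.+ u ℕ.* b₁ → (w ℕ.+ u) ℕ.* p₂ ≡ w ℕ.* a₂ ℕ.+ u ℕ.* b₂ →
    OnSegment ℝ (point (a₁ , a₂)) (point (b₁ , b₂)) (point (p₁ , p₂))
  weighted-mean _ _ _ u w 0<w+u eq₁ eq₂ =
    onSegment (U * D⁻¹) (0≤* (fromNat-mono-≤ {0} {u} z≤n) (<⇒≤ 0<D⁻¹))
      (≤-resp R.refl complement (0≤* (fromNat-mono-≤ {0} {w} z≤n) (<⇒≤ 0<D⁻¹)))
      (mean eq₁) (mean eq₂)
    where
    open SetoidReasoning setoid
    U = fromNat u
    W = fromNat w

    inverse : ∃[ x ] 0# < x × fromNat (w ℕ.+ u) * x ≈ 1#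
    inverse = positive-inverse (fromNat-mono-< 0<w+u)

    D⁻¹ = proj₁ inverse
    0<D⁻¹ = proj₁ (proj₂ inverse)

    [W+U]D⁻¹≈1 : (W + U) * D⁻¹ ≈ 1#
    [W+U]D⁻¹≈1 = R.trans (*-congʳ (R.sym (fromNat-+ w u))) (proj₂ (proj₂ inverse))

    complement : W * D⁻¹ ≈ 1# - U * D⁻¹
    complement = R.trans
      (solve 3 (λ W U D⁻¹ → W :* D⁻¹ := (W :+ U) :* D⁻¹ :- U :* D⁻¹) R.refl W U D⁻¹)
      (+-congʳ [W+U]D⁻¹≈1)

    mean : ∀ {p a b} → (w ℕ.+ u) ℕ.* p ≡ w ℕ.* a ℕ.+ u ℕ.* b →
      fromNat p ≈ fromNat a + U * D⁻¹ * (fromNat b - fromNat a)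
    mean {p} {a} {b} eq = begin
      fromNat p                               ≈⟨ *-identityˡ _ ⟨
      1# * fromNat p                          ≈⟨ *-congʳ [W+U]D⁻¹≈1 ⟨
      (W + U) * D⁻¹ * fromNat p
        ≈⟨ solve 4 (λ W U i p → (W :+ U) :* i :* p := (W :+ U) :* p :* i)
             R.refl W U D⁻¹ (fromNat p) ⟩
      (W + U) * fromNat p * D⁻¹               ≈⟨ *-congʳ scaled ⟩
      (W * fromNat a + U * fromNat b) * D⁻¹
        ≈⟨ solve 5 (λ W U i a b → (W :* a :+ U :* b) :* i :=
             (W :+ U) :* i :* a :+ U :* i :* (b :- a)) R.refl W U D⁻¹ (fromNat a) (fromNat b) ⟩
      (W + U) * D⁻¹ * fromNat a + U * D⁻¹ * (fromNat b - fromNat a)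
        ≈⟨ +-congʳ (R.trans (*-congʳ [W+U]D⁻¹≈1) (*-identityˡ _)) ⟩
      fromNat a + U * D⁻¹ * (fromNat b - fromNat a) ∎
      where
      scaled : (W + U) * fromNat p ≈ W * fromNat a + U * fromNat b
      scaled = begin
        (W + U) * fromNat p               ≈⟨ *-congʳ (fromNat-+ w u) ⟨
        fromNat (w ℕ.+ u) * fromNat p     ≈⟨ fromNat-* (w ℕ.+ u) p ⟨
        fromNat ((w ℕ.+ u) ℕ.* p)         ≡⟨ cong fromNat eq ⟩
        fromNat (w ℕ.* a ℕ.+ u ℕ.* b)     ≈⟨ fromNat-+ (w ℕ.* a) (u ℕ.* b) ⟩
        fromNat (w ℕ.* a) + fromNat (u ℕ.* b) ≈⟨ +-cong (fromNat-* w a) (fromNat-* u b) ⟩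
        W * fromNat a + U * fromNat b     ∎

  on-row : ∀ {a b x} y → Between a b x →
    OnSegment ℝ (point (a , y)) (point (b , y)) (point (x , y))
  on-row {a} {b} {x} y (inj₁ (a<b , a≤x , x≤b)) =
    weighted-mean (a , y) (b , y) (x , y) (x ℕ.∸ a) (b ℕ.∸ x)
      (ℕ.≤-trans (ℕ.m<n⇒0<n∸m a<b) (ℕ.≤-reflexive (sym total)))
      (subst₂ (λ x′ b′ → (b ℕ.∸ x ℕ.+ (x ℕ.∸ a)) ℕ.* x′ ≡ (b ℕ.∸ x) ℕ.* a ℕ.+ (x ℕ.∸ a) ℕ.* b′)
        (ℕ.m+[n∸m]≡n a≤x)
        (trans (sym (ℕ.+-assoc a _ _))
          (trans (cong (ℕ._+ (b ℕ.∸ x)) (ℕ.m+[n∸m]≡n a≤x)) (ℕ.m+[n∸m]≡n x≤b)))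
        (identity a (x ℕ.∸ a) (b ℕ.∸ x)))
      (ℕ.*-distribʳ-+ y (b ℕ.∸ x) (x ℕ.∸ a))
    where
    open +-*-Solver using () renaming (solve to solveℕ; _:=_ to _:≡_; _:+_ to _⊕_; _:*_ to _⊗_)
    identity : ∀ a u w → (w ℕ.+ u) ℕ.* (a ℕ.+ u) ≡ w ℕ.* a ℕ.+ u ℕ.* (a ℕ.+ (u ℕ.+ w))
    identity = solveℕ 3 (λ a u w → (w ⊕ u) ⊗ (a ⊕ u) :≡ w ⊗ a ⊕ u ⊗ (a ⊕ (u ⊕ w))) refl
    total : b ℕ.∸ x ℕ.+ (x ℕ.∸ a) ≡ b ℕ.∸ a
    total = trans (sym (ℕ.+-∸-assoc (b ℕ.∸ x) a≤x)) (cong (ℕ._∸ a) (ℕ.m∸n+n≡m x≤b))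
  on-row {a} {b} y (inj₂ b≤x≤a) = reverse-segment (on-row y (inj₁ b≤x≤a))

  on-column : ∀ {a b y} x → Between a b y →
    OnSegment ℝ (point (x , a)) (point (x , b)) (point (x , y))
  on-column x between = swap-segment (on-row x between)

  onSegment-resp : ∀ {a b p q} → _≈ₚ_ ℝ p q → OnSegment ℝ a b q → OnSegment ℝ a b p
  onSegment-resp (eq₁ , eq₂) (t , 0≤t , t≤1 , q₁≈ , q₂≈) =
    t , 0≤t , t≤1 , R.trans eq₁ q₁≈ , R.trans eq₂ q₂≈

  module _ {e : ℕ} (1≤e : 1 ℕ.≤ e) (parent : Fin e → Fin (suc e))
    (parent≤ : ∀ k → parent k Fin.≤ k)
    (place : Fin (suc e) → ℕ × ℕ) (place-injective : Injective _≡_ _≡_ place) where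

    grid-tree : GeometricTree ℝ e
    grid-tree = record
      { e≥1       = 1≤e
      ; v         = suc e
      ; graph     = graph
      ; connected = connected
      ; acyclic   = acyclic
      ; position  = point ∘ place
      ; distinct  = place-injective ∘ point-injective
      }
      where open ParentTree parent parent≤

  transpose-tree : ∀ {e} → GeometricTree ℝ e → GeometricTree ℝ e
  transpose-tree T = record
    { e≥1       = e≥1
    ; v         = v
    ; graph     = graph
    ; connected = connected
    ; acyclic   = acyclic
    ; position  = swap ∘ position
    ; distinct  = distinct ∘ swap
    }
    where open GeometricTree T

  transpose-cover : ∀ {n m e} → NoncrossingCoveringTree ℝ n m e → NoncrossingCoveringTree ℝ m n e
  transpose-cover (T , noncrossing , covers) = transpose-tree T ,
    (λ k k′ k≢k′ p on on′ →
      let a , end , end′ , p≈ = noncrossing k k′ k≢k′ (swap p) (swap-segment on) (swap-segment on′)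
      in a , end , end′ , swap p≈) ,
    (λ (x , y) (i , j , i≤ , j≤ , x≈ , y≈) →
      let k , on = covers (y , x) (j , i , j≤ , i≤ , y≈ , x≈) in k , swap-segment on)

  -- A spine on column 0 with a tooth on every row.
  module Comb (n m : ℕ) (1≤n : 1 ℕ.≤ n) where

    spine-vertex : Fin (suc m) → Fin (suc m ℕ.+ suc m)
    spine-vertex j = j ↑ˡ suc m

    -- Edge `k` ends at vertex `suc k`. With the spine numbered before the tips, a spine edge leads
    -- to the next spine vertex and a tooth to its tip.
    parent : Fin (m ℕ.+ suc m) → Fin (suc m ℕ.+ suc m)
    parent k = [ spine-vertex ∘ inject₁ , spine-vertex ]′ (splitAt m k)

    parent-spine : ∀ i → parent (i ↑ˡ suc m) ≡ spine-vertex (inject₁ i)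
    parent-spine i = cong [ _ , _ ]′ (Fin.splitAt-↑ˡ m i (suc m))

    parent-tooth : ∀ j → parent (m ↑ʳ j) ≡ spine-vertex j
    parent-tooth j = cong [ _ , _ ]′ (Fin.splitAt-↑ʳ m (suc m) j)

    parent≤ : ∀ k → parent k Fin.≤ k
    parent≤ = ↑-elim m _
      (λ i → ℕ.≤-reflexive (trans (cong toℕ (parent-spine i)) (trans (Fin.toℕ-↑ˡ (inject₁ i) _)
        (trans (Fin.toℕ-inject₁ i) (sym (Fin.toℕ-↑ˡ i _))))))
      (λ j → ℕ.≤-trans (ℕ.≤-reflexive (trans (cong toℕ (parent-tooth j)) (Fin.toℕ-↑ˡ j _)))
        (ℕ.≤-trans (ℕ.m≤n+m (toℕ j) m) (ℕ.≤-reflexive (sym (Fin.toℕ-↑ʳ m j)))))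

    -- Column 0 is outside the grid, which keeps the spine apart from the tips even when `n` is 1.
    place : Fin (suc m ℕ.+ suc m) → ℕ × ℕ
    place a = [ (λ j → 0 , suc (toℕ j)) , (λ j → n , suc (toℕ j)) ]′ (splitAt (suc m) a)

    place-spine : ∀ j → place (spine-vertex j) ≡ (0 , suc (toℕ j))
    place-spine j = cong [ _ , _ ]′ (Fin.splitAt-↑ˡ (suc m) j (suc m))

    place-tip : ∀ j → place (suc m ↑ʳ j) ≡ (n , suc (toℕ j))
    place-tip j = cong [ _ , _ ]′ (Fin.splitAt-↑ʳ (suc m) (suc m) j)

    place-injective : Injective _≡_ _≡_ place
    place-injective {a} {b} eq = trans (sym (Fin.join-splitAt (suc m) (suc m) a)) (trans
      (cong (Fin.join (suc m) (suc m)) (same (splitAt (suc m) a) (splitAt (suc m) b) eq))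
      (Fin.join-splitAt (suc m) (suc m) b))
      where
      row : ∀ {i j : Fin (suc m)} → suc (toℕ i) ≡ suc (toℕ j) → i ≡ j
      row = Fin.toℕ-injective ∘ ℕ.suc-injective

      same : ∀ (s t : Fin (suc m) ⊎ Fin (suc m)) →
        [ (λ j → 0 , suc (toℕ j)) , (λ j → n , suc (toℕ j)) ]′ s ≡
        [ (λ j → 0 , suc (toℕ j)) , (λ j → n , suc (toℕ j)) ]′ t → s ≡ t
      same (inj₁ _) (inj₁ _) eq = cong inj₁ (row (cong proj₂ eq))
      same (inj₁ _) (inj₂ _) eq = contradiction (cong proj₁ eq) (ℕ.<⇒≢ 1≤n)
      same (inj₂ _) (inj₁ _) eq = contradiction (sym (cong proj₁ eq)) (ℕ.<⇒≢ 1≤n)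
      same (inj₂ _) (inj₂ _) eq = cong inj₂ (row (cong proj₂ eq))

    comb : GeometricTree ℝ (m ℕ.+ suc m)
    comb = grid-tree (ℕ.≤-trans (s≤s z≤n) (ℕ.m≤n+m (suc m) m)) parent parent≤ place place-injective

    open GeometricTree comb using (OnEdge; IsEndpoint; Covers; Noncrossing)

    spine-segment : ∀ i {p} → OnEdge (i ↑ˡ suc m) p →
      OnSegment ℝ (point (0 , suc (toℕ i))) (point (0 , suc (suc (toℕ i)))) p
    spine-segment i = subst₂ (λ a b → OnSegment ℝ (point a) (point b) _)
      (trans (cong place (parent-spine i)) (trans (place-spine (inject₁ i))
        (cong (λ h → 0 , suc h) (Fin.toℕ-inject₁ i))))
      (place-spine (suc i))

    tooth-ends : ∀ j → place (parent (m ↑ʳ j)) ≡ (0 , suc (toℕ j))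
    tooth-ends j = trans (cong place (parent-tooth j)) (place-spine j)

    tooth-segment : ∀ j {p} → OnEdge (m ↑ʳ j) p →
      OnSegment ℝ (point (0 , suc (toℕ j))) (point (n , suc (toℕ j))) p
    tooth-segment j = subst₂ (λ a b → OnSegment ℝ (point a) (point b) _)
      (tooth-ends j) (place-tip j)

    covers : Covers (V ℝ n (suc m))
    covers p (x , suc y , (_ , x≤n) , (_ , s≤s y≤m) , p≈) = m ↑ʳ j , onSegment-resp p≈
      (subst₂ (λ a b → OnSegment ℝ (point a) (point b) (point (x , suc y)))
        (sym (trans (tooth-ends j) (cong (λ h → 0 , suc h) (Fin.toℕ-fromℕ< (s≤s y≤m)))))
        (sym (trans (place-tip j) (cong (λ h → n , suc h) (Fin.toℕ-fromℕ< (s≤s y≤m)))))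
        (on-row (suc y) (inj₁ (1≤n , z≤n , x≤n))))
      where
      j : Fin (suc m)
      j = Fin.fromℕ< (s≤s y≤m)

    tooth-height : ∀ j {p} → OnEdge (m ↑ʳ j) p → proj₂ p ≈ fromNat (suc (toℕ j))
    tooth-height j on = stays-level (tooth-segment j on) R.refl R.refl

    spine-column : ∀ i {p} → OnEdge (i ↑ˡ suc m) p → proj₁ p ≈ 0#
    spine-column i on = stays-level (swap-segment (spine-segment i on)) R.refl R.refl

    spine-height : ∀ i {p} → OnEdge (i ↑ˡ suc m) p →
      fromNat (suc (toℕ i)) ≤ proj₂ p × proj₂ p ≤ fromNat (suc (suc (toℕ i)))
    spine-height i {p} on with t , 0≤t , t≤1 , _ , y≈ ← spine-segment i on =
      0≤-⇒≤ (≤-resp R.refl (R.sym (R.trans (+-congʳ y≈)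
        (solve 2 (λ t y → (:1 :- t) :* y :+ t :* (:1 :+ y) :- y := t) R.refl t
          (fromNat (suc (toℕ i)))))) 0≤t) ,
      0≤-⇒≤ (≤-resp R.refl (R.sym (R.trans (+-congˡ (-‿cong y≈))
        (solve 2 (λ t y → :1 :+ y :- ((:1 :- t) :* y :+ t :* (:1 :+ y)) := :1 :- t) R.refl t
          (fromNat (suc (toℕ i)))))) (≤⇒0≤- t≤1))

    -- A spine edge joins consecutive integer heights, so an integer height on it belongs to one of
    -- its ends.
    spine-endpoint : ∀ i j {p} → OnEdge (i ↑ˡ suc m) p → proj₂ p ≈ fromNat (suc (toℕ j)) →
      IsEndpoint (spine-vertex j) (i ↑ˡ suc m)
    spine-endpoint i j on y≈ =
      [ inj₂ ∘ below , inj₁ ∘ above ]′ (ℕ.m≤n⇒m<n∨m≡n i≤j)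
      where
      i≤j : toℕ i ℕ.≤ toℕ j
      i≤j = ℕ.≤-pred (fromNat-cancel-≤ (≤-resp R.refl y≈ (proj₁ (spine-height i on))))
      j≤1+i : toℕ j ℕ.≤ suc (toℕ i)
      j≤1+i = ℕ.≤-pred (fromNat-cancel-≤ (≤-resp y≈ R.refl (proj₂ (spine-height i on))))
      below : toℕ i ℕ.< toℕ j → spine-vertex j ≡ suc (i ↑ˡ suc m)
      below i<j = cong spine-vertex (Fin.toℕ-injective {j = suc i} (ℕ.≤-antisym j≤1+i i<j))
      above : toℕ i ≡ toℕ j → spine-vertex j ≡ parent (i ↑ˡ suc m)
      above i≡j = trans
        (cong spine-vertex (Fin.toℕ-injective (sym (trans (Fin.toℕ-inject₁ i) i≡j))))
        (sym (parent-spine i))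

    Shared : Fin (m ℕ.+ suc m) → Fin (m ℕ.+ suc m) → Point ℝ → Set _
    Shared k k′ p = ∃[ a ] (IsEndpoint a k × IsEndpoint a k′ × _≈ₚ_ ℝ p (point (place a)))

    Shared-sym : ∀ {k k′ p} → Shared k k′ p → Shared k′ k p
    Shared-sym (a , end , end′ , p≈) = a , end′ , end , p≈

    on-spine : ∀ i j {p} → OnEdge (i ↑ˡ suc m) p → proj₂ p ≈ fromNat (suc (toℕ j)) →
      _≈ₚ_ ℝ p (point (place (spine-vertex j)))
    on-spine i j {p} on y≈ = subst (λ q → _≈ₚ_ ℝ p (point q)) (sym (place-spine j))
      (spine-column i on , y≈)

    spine-tooth : ∀ i j {p} → OnEdge (i ↑ˡ suc m) p → OnEdge (m ↑ʳ j) p →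
      Shared (i ↑ˡ suc m) (m ↑ʳ j) p
    spine-tooth i j on on′ = spine-vertex j , spine-endpoint i j on (tooth-height j on′) ,
      inj₁ (sym (parent-tooth j)) , on-spine i j on (tooth-height j on′)

    -- The lower edge ends no higher than the upper one starts, so a common point has height i + 2.
    spine-spine : ∀ i j {p} → i Fin.< j → OnEdge (i ↑ˡ suc m) p → OnEdge (j ↑ˡ suc m) p →
      Shared (i ↑ˡ suc m) (j ↑ˡ suc m) p
    spine-spine i j {p} i<j on on′ = spine-vertex (suc i) ,
      spine-endpoint i (suc i) on y≈ , spine-endpoint j (suc i) on′ y≈ , on-spine i (suc i) on y≈
      where
      y≈ : proj₂ p ≈ fromNat (suc (suc (toℕ i)))
      y≈ = ≤-antisym (proj₂ (spine-height i on))
        (≤-trans (fromNat-mono-≤ (s≤s i<j)) (proj₁ (spine-height j on′)))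

    noncrossing : Noncrossing
    noncrossing = ↑-elim m Separate
      (λ i → ↑-elim m _ (spines i) (λ j _ p → spine-tooth i j))
      (λ j → ↑-elim m _
        (λ i _ p on on′ → Shared-sym (spine-tooth i j on′ on))
        (λ j′ k≢k′ p on on′ → contradiction (cong (m ↑ʳ_) (Fin.toℕ-injective (ℕ.suc-injective
          (fromNat-injective (R.trans (R.sym (tooth-height j on)) (tooth-height j′ on′)))))) k≢k′))
      where
      Separate : Fin (m ℕ.+ suc m) → Set _
      Separate k = ∀ k′ → k ≢ k′ → ∀ p → OnEdge k p → OnEdge k′ p → Shared k k′ p

      spines : ∀ i i′ → i ↑ˡ suc m ≢ i′ ↑ˡ suc m → ∀ p →
        OnEdge (i ↑ˡ suc m) p → OnEdge (i′ ↑ˡ suc m) p → Shared (i ↑ˡ suc m) (i′ ↑ˡ suc m) p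
      spines i i′ i≢i′ p on on′ with Fin.<-cmp i i′
      ... | tri< i<i′ _ _ = spine-spine i i′ i<i′ on on′
      ... | tri≈ _ i≡i′ _ = contradiction (cong (_↑ˡ suc m) i≡i′) i≢i′
      ... | tri> _ _ i′<i = Shared-sym (spine-spine i′ i i′<i on′ on)

-- The spiral

-- Numbering ℤ as c , c + 1 , c − 1 , c + 2 , … : the pair (s , false) stands
-- for c − s, and (s , true) for c + 1 + s.
next : ℕ × Bool → ℕ × Bool
next (s , false) = s , true
next (s , true)  = suc s , false

rank : ℕ → ℕ × Bool
rank zero    = 0 , false
rank (suc t) = next (rank t)

index : ℕ × Bool → ℕ
index (s , false) = s ℕ.* 2
index (s , true)  = suc (s ℕ.* 2)

index-next : ∀ r → index (next r) ≡ suc (index r)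
index-next (s , false) = refl
index-next (s , true)  = refl

index-rank : ∀ t → index (rank t) ≡ t
index-rank zero    = refl
index-rank (suc t) = trans (index-next (rank t)) (cong suc (index-rank t))

rank-double : ∀ s → rank (s ℕ.* 2) ≡ (s , false)
rank-double zero    = refl
rank-double (suc s) = cong (next ∘ next) (rank-double s)

rank-index : ∀ r → rank (index r) ≡ r
rank-index (s , false) = rank-double s
rank-index (s , true)  = cong next (rank-double s)

module Outward (c : ℕ) where

  value : ℕ × Bool → ℕ
  value (s , false) = c ℕ.∸ s
  value (s , true)  = suc c ℕ.+ s

  position : ℕ → ℕ
  position t = value (rank t)

  -- The interval spanned by the values of `r` and `next r`. It grows with `r`, so it contains all
  -- earlier positions.
  Hull : ℕ × Bool → ℕ → Set
  Hull (s , false) x = c ℕ.∸ s ℕ.≤ x × x ℕ.≤ suc c ℕ.+ s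
  Hull (s , true)  x = c ℕ.∸ suc s ℕ.≤ x × x ℕ.≤ suc c ℕ.+ s

  hull-between : ∀ r {x} → Hull r x → Between (value r) (value (next r)) x
  hull-between (s , false) (lo , hi) =
    inj₁ (ℕ.≤-trans (s≤s (ℕ.m∸n≤m c s)) (ℕ.m≤m+n (suc c) s) , lo , hi)
  hull-between (s , true) (lo , hi) =
    inj₂ (ℕ.≤-trans (s≤s (ℕ.m∸n≤m c (suc s))) (ℕ.m≤m+n (suc c) s) , lo , hi)

  hull-next : ∀ r {x} → Hull r x → Hull (next r) x
  hull-next (s , false) (lo , hi) = ℕ.≤-trans (ℕ.∸-monoʳ-≤ c (ℕ.n≤1+n s)) lo , hi
  hull-next (s , true)  (lo , hi) = lo , ℕ.≤-trans hi (ℕ.+-monoʳ-≤ (suc c) (ℕ.n≤1+n s))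

  hull-value : ∀ r → Hull r (value r)
  hull-value (s , false) = ℕ.≤-refl , ℕ.≤-trans (ℕ.m∸n≤m c s) (ℕ.m≤n⇒m≤o+n 1 (ℕ.m≤m+n c s))
  hull-value (s , true)  =
    ℕ.≤-trans (ℕ.m∸n≤m c (suc s)) (ℕ.m≤n⇒m≤o+n 1 (ℕ.m≤m+n c s)) , ℕ.≤-refl

  hull-next-value : ∀ r → Hull r (value (next r))
  hull-next-value (s , false) = ℕ.≤-trans (ℕ.m∸n≤m c s) (ℕ.m≤n⇒m≤o+n 1 (ℕ.m≤m+n c s)) , ℕ.≤-refl
  hull-next-value (s , true)  =
    ℕ.≤-refl , ℕ.≤-trans (ℕ.m∸n≤m c (suc s)) (ℕ.m≤n⇒m≤o+n 1 (ℕ.m≤m+n c s))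

  hull : ∀ s t → s ℕ.≤ suc t → Hull (rank t) (position s)
  hull s zero s≤1 with s
  ... | zero        = hull-value (rank 0)
  ... | suc zero    = hull-next-value (rank 0)
  ... | suc (suc _) = contradiction s≤1 λ { (s≤s ()) }
  hull s (suc t) s≤2+t with ℕ.m≤n⇒m<n∨m≡n s≤2+t
  ... | inj₁ (s≤s s≤1+t) = hull-next (rank t) (hull s t s≤1+t)
  ... | inj₂ refl        = hull-next-value (rank (suc t))

  between : ∀ s t → s ℕ.≤ suc t → Between (position t) (position (suc t)) (position s)
  between s t s≤1+t = hull-between (rank t) (hull s t s≤1+t)

  -- In this range the subtraction in `value` is not truncated, as injectivity requires.
  radius-≤ : ∀ t → t ℕ.≤ c ℕ.* 2 → proj₁ (rank t) ℕ.≤ c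
  radius-≤ t t≤2c = ℕ.*-cancelʳ-≤ _ _ 2 (ℕ.≤-trans (double-≤ (rank t))
    (ℕ.≤-trans (ℕ.≤-reflexive (index-rank t)) t≤2c))
    where
    double-≤ : ∀ r → proj₁ r ℕ.* 2 ℕ.≤ index r
    double-≤ (s , false) = ℕ.≤-refl
    double-≤ (s , true)  = ℕ.n≤1+n _

  value-injective : ∀ r r′ → proj₁ r ℕ.≤ c → proj₁ r′ ℕ.≤ c → value r ≡ value r′ → r ≡ r′
  value-injective (s , false) (s′ , false) s≤c s′≤c eq = cong (_, false) (ℕ.∸-cancelˡ-≡ s≤c s′≤c eq)
  value-injective (s , false) (s′ , true)  _ _ eq =
    contradiction eq (ℕ.<⇒≢ (ℕ.≤-trans (s≤s (ℕ.m∸n≤m c s)) (ℕ.m≤m+n (suc c) s′)))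
  value-injective (s , true)  (s′ , false) _ _ eq =
    contradiction (sym eq) (ℕ.<⇒≢ (ℕ.≤-trans (s≤s (ℕ.m∸n≤m c s′)) (ℕ.m≤m+n (suc c) s)))
  value-injective (s , true)  (s′ , true)  _ _ eq = cong (_, true) (ℕ.+-cancelˡ-≡ (suc c) s s′ eq)

  position-injective : ∀ {s t} → s ℕ.≤ c ℕ.* 2 → t ℕ.≤ c ℕ.* 2 → position s ≡ position t → s ≡ t
  position-injective {s} {t} s≤ t≤ eq = trans (sym (index-rank s)) (trans
    (cong index (value-injective (rank s) (rank t) (radius-≤ s s≤) (radius-≤ t t≤) eq))
    (index-rank t))

  -- The hypotheses make `c` half of `n` rounded up, the centre for which the first `n` positions
  -- are exactly 1 to n.
  position-surjective : ∀ {n} → n ℕ.≤ c ℕ.* 2 → c ℕ.* 2 ℕ.≤ suc n → ∀ x → 1 ℕ.≤ x → x ℕ.≤ n →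
    ∃[ t ] t ℕ.< n × position t ≡ x
  position-surjective {n} n≤2c 2c≤1+n x 1≤x x≤n with x ℕ.≤? c
  ... | yes x≤c = index (c ℕ.∸ x , false) , ℕ.≤-pred (ℕ.≤-trans (ℕ.*-monoˡ-≤ 2 1+d≤c) 2c≤1+n) ,
    trans (cong value (rank-index (c ℕ.∸ x , false))) (ℕ.m∸[m∸n]≡n x≤c)
    where
    1+d≤c : suc (c ℕ.∸ x) ℕ.≤ c
    1+d≤c = ℕ.≤-trans (ℕ.+-monoˡ-≤ (c ℕ.∸ x) 1≤x) (ℕ.≤-reflexive (ℕ.m+[n∸m]≡n x≤c))
  ... | no x≰c = index (s , true) , ℕ.+-cancelˡ-≤ n _ _ 2s+2+n≤2n ,
    trans (cong value (rank-index (s , true))) (ℕ.m+[n∸m]≡n (ℕ.≰⇒> x≰c))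
    where
    s : ℕ
    s = x ℕ.∸ suc c

    2s+2+n≤2n : n ℕ.+ suc s ℕ.* 2 ℕ.≤ n ℕ.+ n
    2s+2+n≤2n = begin
      n ℕ.+ suc s ℕ.* 2          ≤⟨ ℕ.+-monoˡ-≤ _ n≤2c ⟩
      c ℕ.* 2 ℕ.+ suc s ℕ.* 2    ≡⟨ ℕ.*-distribʳ-+ 2 c (suc s) ⟨
      (c ℕ.+ suc s) ℕ.* 2        ≡⟨ cong (ℕ._* 2) (trans (ℕ.+-suc c s) (ℕ.m+[n∸m]≡n (ℕ.≰⇒> x≰c))) ⟩
      x ℕ.* 2                    ≤⟨ ℕ.*-monoˡ-≤ 2 x≤n ⟩
      n ℕ.* 2                    ≡⟨ ℕ.*-comm n 2 ⟩
      n ℕ.+ (n ℕ.+ 0)            ≡⟨ cong (n ℕ.+_) (ℕ.+-identityʳ n) ⟩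
      n ℕ.+ n                    ∎
      where open ℕ.≤-Reasoning

-- The vertices of the spiral, as pairs of arguments of Outward.position.
stair : ℕ → ℕ × ℕ
stair 0             = 2 , 3
stair 1             = 3 , 3
stair (suc (suc i)) = Product.map suc suc (stair i)

vertex : ℕ → ℕ × ℕ
vertex 0                         = 1 , 1
vertex 1                         = 2 , 2
vertex 2                         = 3 , 2
vertex 3                         = 0 , 1
vertex (suc (suc (suc (suc i)))) = stair i

stair-sum : ∀ i → proj₁ (stair i) ℕ.+ proj₂ (stair i) ≡ 5 ℕ.+ i
stair-sum 0             = refl
stair-sum 1             = refl
stair-sum (suc (suc i)) = cong suc (trans (ℕ.+-suc _ _) (cong suc (stair-sum i)))

stair-high : ∀ i → 3 ℕ.≤ proj₂ (stair i)
stair-high 0             = ℕ.≤-refl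
stair-high 1             = ℕ.≤-refl
stair-high (suc (suc i)) = ℕ.m≤n⇒m≤1+n (stair-high i)

stair-≤ : ∀ i b → i ℕ.≤ b ℕ.* 2 → proj₁ (stair i) ℕ.≤ 3 ℕ.+ b × proj₂ (stair i) ℕ.≤ 3 ℕ.+ b
stair-≤ 0 b _ = ℕ.m≤n⇒m≤1+n (ℕ.m≤m+n 2 b) , ℕ.m≤m+n 3 b
stair-≤ 1 b _ = ℕ.m≤m+n 3 b , ℕ.m≤m+n 3 b
stair-≤ (suc (suc i)) (suc b) (s≤s (s≤s i≤2b)) with stair-≤ i b i≤2b
... | x≤ , y≤ = s≤s x≤ , s≤s y≤

stair-even : ∀ i → stair (i ℕ.* 2) ≡ (2 ℕ.+ i , 3 ℕ.+ i)
stair-even zero    = refl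
stair-even (suc i) = cong (Product.map suc suc) (stair-even i)

stair-odd : ∀ i → stair (suc (i ℕ.* 2)) ≡ (3 ℕ.+ i , 3 ℕ.+ i)
stair-odd zero    = refl
stair-odd (suc i) = cong (Product.map suc suc) (stair-odd i)

-- A left inverse of `vertex`. Each step of the stair raises the coordinate sum by one, so there the
-- index is that sum minus 1.
vertex-index : ℕ × ℕ → ℕ
vertex-index (zero , 1)              = 3
vertex-index (x , 2)                 = ℕ.pred x
vertex-index (x , suc (suc (suc y))) = x ℕ.+ (2 ℕ.+ y)
vertex-index _                       = 0

vertex-index-vertex : ∀ i → vertex-index (vertex i) ≡ i
vertex-index-vertex 0 = refl
vertex-index-vertex 1 = refl
vertex-index-vertex 2 = refl
vertex-index-vertex 3 = refl
vertex-index-vertex (suc (suc (suc (suc i)))) =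
  trans (high (proj₁ (stair i)) (proj₂ (stair i)) (stair-high i)) (cong ℕ.pred (stair-sum i))
  where
  high : ∀ x y → 3 ℕ.≤ y → vertex-index (x , y) ≡ ℕ.pred (x ℕ.+ y)
  high zero    (suc (suc (suc y))) _ = refl
  high (suc x) (suc (suc (suc y))) _ = sym (ℕ.+-suc x (2 ℕ.+ y))
  high zero    1 (s≤s ())
  high zero    2 (s≤s (s≤s ()))
  high (suc x) 1 (s≤s ())
  high (suc x) 2 (s≤s (s≤s ()))

vertex-injective : ∀ {i j} → vertex i ≡ vertex j → i ≡ j
vertex-injective {i} {j} eq =
  trans (sym (vertex-index-vertex i)) (trans (cong vertex-index eq) (vertex-index-vertex j))

vertex-≤ : ∀ i b → i ℕ.≤ 4 ℕ.+ b ℕ.* 2 →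
  proj₁ (vertex i) ℕ.≤ 3 ℕ.+ b × proj₂ (vertex i) ℕ.≤ 3 ℕ.+ b
vertex-≤ 0 b _ = s≤s z≤n , s≤s z≤n
vertex-≤ 1 b _ = s≤s (s≤s z≤n) , s≤s (s≤s z≤n)
vertex-≤ 2 b _ = ℕ.m≤m+n 3 b , s≤s (s≤s z≤n)
vertex-≤ 3 b _ = z≤n , s≤s z≤n
vertex-≤ (suc (suc (suc (suc i)))) b (s≤s (s≤s (s≤s (s≤s i≤2b)))) = stair-≤ i b i≤2b

-- Edges 0 to 3 solve the nine dots puzzle on the inner 3 × 3 square, and the
-- later edges wind around it.
module Spiral {c ℓ₁ ℓ₂ ℓ₃} (ℝ : RealNumbers c ℓ₁ ℓ₂ ℓ₃) (b d : ℕ)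
  (n≤2c : 3 ℕ.+ b ℕ.≤ suc d ℕ.* 2) (2c≤1+n : suc d ℕ.* 2 ℕ.≤ 4 ℕ.+ b) where

  open GridTrees ℝ
  open Segments ℝ using (start; end)
  open Outward (suc d) renaming (position to pos)

  at : ℕ × ℕ → ℕ × ℕ
  at = Product.map pos pos

  size : ℕ
  size = 4 ℕ.+ b ℕ.* 2

  parent : Fin size → Fin (suc size)
  -- Prolonged by one step, the second oblique edge would reach vertex 4 and close a cycle through
  -- the corner, vertex 1. It stops at vertex 3, its last grid point, and vertex 4 is attached to
  -- the corner instead.
  parent (suc (suc (suc zero))) = suc zero
  parent k                      = inject₁ k

  parent≤ : ∀ k → parent k Fin.≤ k
  parent≤ zero                          = z≤n
  parent≤ (suc zero)                    = s≤s z≤n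
  parent≤ (suc (suc zero))              = s≤s (s≤s z≤n)
  parent≤ (suc (suc (suc zero)))        = s≤s z≤n
  parent≤ k@(suc (suc (suc (suc _))))   = ℕ.≤-reflexive (Fin.toℕ-inject₁ k)

  place : Fin (suc size) → ℕ × ℕ
  place a = at (vertex (toℕ a))

  place-injective : Injective _≡_ _≡_ place
  place-injective {a} {a′} eq = Fin.toℕ-injective (vertex-injective (cong₂ _,_
    (position-injective (proj₁ (in-range a)) (proj₁ (in-range a′)) (cong proj₁ eq))
    (position-injective (proj₂ (in-range a)) (proj₂ (in-range a′)) (cong proj₂ eq))))
    where
    in-range : ∀ a → proj₁ (vertex (toℕ a)) ℕ.≤ suc d ℕ.* 2 × proj₂ (vertex (toℕ a)) ℕ.≤ suc d ℕ.* 2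
    in-range a with x≤ , y≤ ← vertex-≤ (toℕ a) b (ℕ.≤-pred (Fin.toℕ<n a)) =
      ℕ.≤-trans x≤ n≤2c , ℕ.≤-trans y≤ n≤2c

  spiral : GeometricTree ℝ size
  spiral = grid-tree (s≤s z≤n) parent parent≤ place place-injective

  open GeometricTree spiral using (OnEdge; Covers)

  Covered : ℕ × ℕ → Set _
  Covered p = ∃[ k ] OnEdge k (point (at p))

  later-edge : ∀ {p q} r i → i ℕ.< b ℕ.* 2 → stair i ≡ p → stair (suc i) ≡ q →
    OnSegment ℝ (point (at p)) (point (at q)) (point (at r)) → Covered r
  later-edge r i i<2b refl refl on = suc (suc (suc (suc k))) ,
    subst₂ (λ i j → OnSegment ℝ (point (at (stair i))) (point (at (stair (suc j)))) (point (at r)))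
      (sym (trans (Fin.toℕ-inject₁ k) (Fin.toℕ-fromℕ< i<2b))) (sym (Fin.toℕ-fromℕ< i<2b)) on
    where
    k : Fin (b ℕ.* 2)
    k = Fin.fromℕ< i<2b

  -- From number 3 on, row t is traversed from position t - 1 to position t and column s from
  -- position s to s + 1. So rows handle s ≤ t and columns t ≤ s.
  covered-row : ∀ s t → s ℕ.≤ t → t ℕ.< 3 ℕ.+ b → Covered (s , t)
  covered-row zero       zero       _   _ = zero ,
    -- The centre is the midpoint of the first oblique edge; since the centre coordinate is `suc d`,
    -- its predecessor is simply `d`.
    weighted-mean (at (1 , 1)) (at (2 , 2)) (at (0 , 0)) 1 1 (s≤s z≤n) mean mean
    where
    open +-*-Solver
    mean : 2 ℕ.* suc d ≡ 1 ℕ.* (suc (suc d) ℕ.+ 0) ℕ.+ 1 ℕ.* d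
    mean = solve 1 (λ d → con 2 :* (con 1 :+ d) :=
      con 1 :* (con 2 :+ d :+ con 0) :+ con 1 :* d) refl d
  covered-row zero       (suc zero) _   _ = suc (suc zero) , end _ _
  covered-row (suc zero) (suc zero) _   _ = zero , start _ _
  covered-row s          2          s≤2 _ =
    suc zero , on-row (pos 2) (between s 2 (ℕ.m≤n⇒m≤1+n s≤2))
  covered-row s (suc (suc (suc i))) s≤t (s≤s (s≤s (s≤s i<b))) =
    later-edge (s , 3 ℕ.+ i) (i ℕ.* 2) (ℕ.≤-trans (ℕ.n≤1+n _) (ℕ.*-monoˡ-≤ 2 i<b))
      (stair-even i) (stair-odd i)
      (on-row (pos (3 ℕ.+ i)) (between s (2 ℕ.+ i) s≤t))
  covered-row (suc (suc _)) (suc zero) (s≤s ()) _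

  covered-column : ∀ s t → t ℕ.≤ s → s ℕ.< 3 ℕ.+ b → Covered (s , t)
  covered-column (suc zero) zero _ _ = suc (suc zero) ,
    -- The right neighbour of the centre is the midpoint of the second oblique edge.
    weighted-mean (at (3 , 2)) (at (0 , 1)) (at (1 , 0)) 1 1 (s≤s z≤n) mean₁ mean₂
    where
    open +-*-Solver
    mean₁ : 2 ℕ.* (suc (suc d) ℕ.+ 0) ≡ 1 ℕ.* (suc (suc d) ℕ.+ 1) ℕ.+ 1 ℕ.* suc d
    mean₁ = solve 1 (λ d → con 2 :* (con 2 :+ d :+ con 0) :=
      con 1 :* (con 2 :+ d :+ con 1) :+ con 1 :* (con 1 :+ d)) refl d
    mean₂ : 2 ℕ.* suc d ≡ 1 ℕ.* d ℕ.+ 1 ℕ.* (suc (suc d) ℕ.+ 0)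
    mean₂ = solve 1 (λ d → con 2 :* (con 1 :+ d) :=
      con 1 :* d :+ con 1 :* (con 2 :+ d :+ con 0)) refl d
  covered-column zero zero t≤s s< = covered-row zero zero t≤s s<
  covered-column (suc zero) (suc zero) _ s< = covered-row 1 1 ℕ.≤-refl s<
  covered-column 2 t t≤2 _ = suc (suc (suc zero)) ,
    on-column (pos 2) (between t 2 (ℕ.m≤n⇒m≤1+n t≤2))
  covered-column (suc (suc (suc i))) t t≤s (s≤s (s≤s (s≤s i<b))) =
    later-edge (3 ℕ.+ i , t) (suc (i ℕ.* 2)) (ℕ.*-monoˡ-≤ 2 i<b) (stair-odd i) (stair-even (suc i))
      (on-column (pos (3 ℕ.+ i)) (between t (3 ℕ.+ i) (ℕ.m≤n⇒m≤1+n t≤s)))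
  covered-column (suc zero) (suc (suc _)) (s≤s ()) _

  covered : ∀ s t → s ℕ.< 3 ℕ.+ b → t ℕ.< 3 ℕ.+ b → Covered (s , t)
  covered s t s<n t<n =
    [ (λ s≤t → covered-row s t s≤t t<n) , (λ t≤s → covered-column s t t≤s s<n) ]′ (ℕ.≤-total s t)

  covers : Covers (V ℝ (3 ℕ.+ b) (3 ℕ.+ b))
  covers p (x , y , (1≤x , x≤n) , (1≤y , y≤n) , p≈) =
    let s , s<n , x≡ = position-surjective n≤2c 2c≤1+n x 1≤x x≤n
        t , t<n , y≡ = position-surjective n≤2c 2c≤1+n y 1≤y y≤n
        k , on = covered s t s<n t<n
    in k , onSegment-resp p≈ (subst (OnEdge k ∘ point) (cong₂ _,_ x≡ y≡) on)

-- The minimum numbers of edges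

2*⊓<+ : ∀ n m → n ≢ m → 2 ℕ.* (n ℕ.⊓ m) ℕ.< n ℕ.+ m
2*⊓<+ n m n≢m with ℕ.<-cmp n m
... | tri< n<m _ _ = ℕ.+-mono-≤-< (ℕ.m⊓n≤m n m)
  (ℕ.≤-<-trans (ℕ.≤-reflexive (ℕ.+-identityʳ _)) (ℕ.≤-<-trans (ℕ.m⊓n≤m n m) n<m))
... | tri≈ _ n≡m _ = contradiction n≡m n≢m
... | tri> _ _ m<n = ℕ.+-mono-<-≤ (ℕ.≤-<-trans (ℕ.m⊓n≤n n m) m<n)
  (ℕ.≤-trans (ℕ.≤-reflexive (ℕ.+-identityʳ _)) (ℕ.m⊓n≤n n m))

half : ∀ b → ∃[ d ] 3 ℕ.+ b ℕ.≤ suc d ℕ.* 2 × suc d ℕ.* 2 ℕ.≤ 4 ℕ.+ b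
half 0             = 1 , s≤s (s≤s (s≤s z≤n)) , ℕ.≤-refl
half 1             = 1 , ℕ.≤-refl , ℕ.n≤1+n 4
half (suc (suc b)) = let d , lo , hi = half b in suc d , s≤s (s≤s lo) , s≤s (s≤s hi)

module _ {c ℓ₁ ℓ₂ ℓ₃} (ℝ : RealNumbers c ℓ₁ ℓ₂ ℓ₃) where

  open GridTrees ℝ using (module Comb; transpose-cover)

  comb-cover : ∀ n m → 1 ℕ.≤ n → 1 ℕ.≤ m → NoncrossingCoveringTree ℝ n m (2 ℕ.* m ℕ.∸ 1)
  comb-cover n (suc m) 1≤n _ = subst (NoncrossingCoveringTree ℝ n (suc m))
    (cong (λ k → m ℕ.+ suc k) (sym (ℕ.+-identityʳ m))) (comb , noncrossing , covers)
    where open Comb n m 1≤n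

  noncrossing-cover : ∀ n m → 1 ℕ.≤ n → 1 ℕ.≤ m →
    NoncrossingCoveringTree ℝ n m (2 ℕ.* (n ℕ.⊓ m) ℕ.∸ 1)
  noncrossing-cover n m 1≤n 1≤m =
    [ (λ n≤m → subst (λ k → NoncrossingCoveringTree ℝ n m (2 ℕ.* k ℕ.∸ 1)) (sym (ℕ.m≤n⇒m⊓n≡m n≤m))
        (transpose-cover (comb-cover m n 1≤m 1≤n)))
    , (λ m≤n → subst (λ k → NoncrossingCoveringTree ℝ n m (2 ℕ.* k ℕ.∸ 1)) (sym (ℕ.m≥n⇒m⊓n≡n m≤n))
        (comb-cover n m 1≤n 1≤m))
    ]′ (ℕ.≤-total n m)

  crossing-cover : ∀ n → 3 ℕ.≤ n → CoveringTree ℝ n n (2 ℕ.* (n ℕ.⊓ n) ℕ.∸ 2)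
  crossing-cover 1 (s≤s ())
  crossing-cover 2 (s≤s (s≤s ()))
  crossing-cover (suc (suc (suc b))) _ =
    subst (CoveringTree ℝ (3 ℕ.+ b) (3 ℕ.+ b)) edges (spiral , covers)
    where
    open Spiral ℝ b (proj₁ (half b)) (proj₁ (proj₂ (half b))) (proj₂ (proj₂ (half b)))

    edges : 4 ℕ.+ b ℕ.* 2 ≡ 2 ℕ.* ((3 ℕ.+ b) ℕ.⊓ (3 ℕ.+ b)) ℕ.∸ 2
    edges = trans (cong (ℕ._∸ 2) (ℕ.*-comm (3 ℕ.+ b) 2))
      (cong (λ k → 2 ℕ.* k ℕ.∸ 2) (sym (ℕ.⊓-idem (3 ℕ.+ b))))

  crossing-bound : ∀ n m e → CoveringTree ℝ n m e → 2 ℕ.* (n ℕ.⊓ m) ℕ.≤ 2 ℕ.+ e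
  crossing-bound n m e (T , covers) =
    [ ℕ.m≤n⇒m≤1+n , ℕ.≤-trans (2*⊓≤+ n m) ]′ (LowerBound.Grid.edge-count ℝ T n m covers)

  noncrossing-bound : ∀ n m e → NoncrossingCoveringTree ℝ n m e → 2 ℕ.* (n ℕ.⊓ m) ℕ.≤ suc e
  noncrossing-bound n m e (T , noncrossing , covers) =
    LowerBound.Grid.edge-count-shared ℝ T n m covers λ k k′ k≢k′ p on on′ →
      let a , end , end′ , _ = noncrossing k k′ k≢k′ p on on′ in a , end , end′

  -- If n ≠ m, then n + m exceeds 2 min(n, m), which supplies the missing edge. A square of side at
  -- most 2 asks for no more than three edges, and with fewer edges any two share an endpoint.
  generic-bound : ∀ n m e → ¬ (n ≡ m × 3 ℕ.≤ m) → CoveringTree ℝ n m e → 2 ℕ.* (n ℕ.⊓ m) ℕ.≤ suc e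
  generic-bound n m e ¬large-square (T , covers) = [ id , from-sum (n ℕ.≟ m) ]′ edge-count
    where
    open LowerBound ℝ T
    open Grid n m covers

    small-square : ¬ 3 ℕ.≤ m → Dec (e ℕ.≤ 2) → 2 ℕ.* (n ℕ.⊓ m) ℕ.≤ suc e
    small-square _   (yes e≤2) = edge-count-shared (two-edges-share e≤2)
    small-square m≱3 (no e≰2)  = ℕ.≤-trans
      (ℕ.*-monoʳ-≤ 2 (ℕ.≤-trans (ℕ.m⊓n≤n n m) (ℕ.≤-pred (ℕ.≰⇒> m≱3)))) (s≤s (ℕ.≰⇒> e≰2))

    from-sum : Dec (n ≡ m) → n ℕ.+ m ℕ.≤ 2 ℕ.+ e → 2 ℕ.* (n ℕ.⊓ m) ℕ.≤ suc e
    from-sum (yes n≡m) _       = small-square (λ 3≤m → ¬large-square (n≡m , 3≤m)) (e ℕ.≤? 2)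
    from-sum (no n≢m)  n+m≤2+e = ℕ.≤-pred (ℕ.≤-trans (2*⊓<+ n m n≢m) n+m≤2+e)

open import Data.Nat.Base using (_*_; _∸_; _⊓_; _≤_)

theorem4 : ∀ {c ℓ₁ ℓ₂ ℓ₃} (ℝ : RealNumbers c ℓ₁ ℓ₂ ℓ₃) (n m : ℕ) → 1 ≤ n → 1 ≤ m →
    ((n ≡ m × 3 ≤ m) → IsMinimum (CoveringTree ℝ n m) (2 * (n ⊓ m) ∸ 2)) ×
    (¬ (n ≡ m × 3 ≤ m) → IsMinimum (CoveringTree ℝ n m) (2 * (n ⊓ m) ∸ 1)) ×
    IsMinimum (NoncrossingCoveringTree ℝ n m) (2 * (n ⊓ m) ∸ 1)
theorem4 ℝ n m 1≤n 1≤m =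
  (λ { (refl , 3≤n) → crossing-cover ℝ n 3≤n ,
         λ e T → ℕ.m≤n+o⇒m∸n≤o _ 2 (crossing-bound ℝ n n e T) }) ,
  (λ ¬large-square → (let T , _ , covers = noncrossing-cover ℝ n m 1≤n 1≤m in T , covers) ,
     λ e T → ℕ.m≤n+o⇒m∸n≤o _ 1 (generic-bound ℝ n m e ¬large-square T)) ,
  noncrossing-cover ℝ n m 1≤n 1≤m ,
  λ e T → ℕ.m≤n+o⇒m∸n≤o _ 1 (noncrossing-bound ℝ n m e T)
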